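{- For $n\ge0$ define $$\widehat{\widehat P}_n(x_1,x_2,y_1,\hat y_2,u_1,u_2,v_1,\hat v_2,w_{\mathrm e},w_{\mathrm o},z_{\mathrm e},z_{\mathrm o},\lambda)=\sum_{\sigma\in\mathfrak D_{2n}}x_1^{\mathrm{eareccpeak}(\sigma)}x_2^{\mathrm{eareccdfall}(\sigma)}y_1^{\mathrm{ereccval}(\sigma)}\hat y_2^{\mathrm{ereccdrise}'(\sigma)}u_1^{\mathrm{nrcpeak}(\sigma)}u_2^{\mathrm{nrcdfall}(\sigma)}v_1^{\mathrm{nrcval}(\sigma)}\hat v_2^{\mathrm{nrcdrise}'(\sigma)}w_{\mathrm e}^{\mathrm{evennrfix}(\sigma)}w_{\mathrm o}^{\mathrm{oddnrfix}(\sigma)}z_{\mathrm e}^{\mathrm{evenrar}(\sigma)}z_{\mathrm o}^{\mathrm{oddrar}(\sigma)}\lambda^{\mathrm{cyc}(\sigma)}.$$ Then $\sum_{n\ge0}\widehat{\widehat P}_n(x_1,x_2,y_1,\hat y_2,u_1,u_2,y_1,\hat v_2,w_{\mathrm e},w_{\mathrm o},z_{\mathrm e},z_{\mathrm o},\lambda)\,t^n$ (i.e. with $v_1=y_1$) equals the T-type continued fraction with coefficients $\alpha_{2k-1}=(\lambda+k-1)\,[x_1+(k-1)u_1]\,y_1$, $\alpha_{2k}=[x_2+(k-1)u_2+\lambda w_{\mathrm e}]\,[\hat y_2+(k-1)\hat v_2+\lambda w_{\mathrm o}]$ for $k\ge1$, $\delta_1=\lambda^2z_{\mathrm e}z_{\mathrm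 o}$, $\delta_n=0$ for $n\ge2$.
   Context: $\mathfrak D_{2n}$: permutations $\sigma$ of $[2n]$ with $\sigma(2k-1)\ge2k-1$ and $\sigma(2k)\le2k$ for all $k\in[n]$. $\mathrm{cyc}(\sigma)$ is the number of cycles of $\sigma$ (fixed points count as cycles). Index $i$ is a cycle peak / valley / double rise / double fall if respectively $\sigma^{ -1}(i)<i>\sigma(i)$ / $\sigma^{ -1}(i)>i<\sigma(i)$ / $\sigma^{ -1}(i)<i<\sigma(i)$ / $\sigma^{ -1}(i)>i>\sigma(i)$. Record: $\sigma(j)<\sigma(i)$ for all $j<i$; antirecord: $\sigma(j)>\sigma(i)$ for all $j>i$; exclusive record = record not antirecord; exclusive antirecord = antirecord not record; record-antirecord = both; neither-record-antirecord = neither. $\mathrm{eareccpeak},\mathrm{eareccdfall}$ = number of exclusive antirecords that are cycle peaks, resp. cycle double falls; $\mathrm{ereccval}$ = exclusive records that are cycle valleys; $\mathrm{nrcpeak},\mathrm{nrcdfall},\mathrm{nrcval}$ = neither-record-antirecords that are cycle peaks, double falls, valleys; $\mathrm{ereccdrise}'(\sigma)$ = number of cycle double rises $i$ such that $\sigma^{ -1}(i)$ is a record; $\mathrm{nrcdrise}'(\sigma)$ = number of cycle double rises $i$ such that $\sigma^{ -1}(i)$ is not a record; $\mathrm{evennrfix},\mathrm{oddnrfix}$ = even/odd fixed points that are neither-record-antirecords; $\mathrm{evenrar},\mathrm{oddrar}$ = even/odd record-antirecords. T-type continued fraction with coefficients $(\alpha_n),(\delta_n)$: the formal power series $1/(1-\delta_1t-\alpha_1t/(1-\delta_2t-\alpha_2t/(1-\delta_3t-\cdots)))$.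 -}

module Defs where

open import Data.Bool using (Bool; true; false; _∧_; not; if_then_else_)
open import Data.Nat using (ℕ; zero; suc; _∸_; _≡ᵇ_; _<ᵇ_; _≤ᵇ_; _%_; _/_)
import Data.Nat as ℕ
open import Data.List using (List; []; _∷_; map; concatMap; upTo; length; filterᵇ; foldr)
all : {A : Set} → (A → Bool) → List A → Bool
all p []       = true
all p (x ∷ xs) = p x ∧ all p xs

open import Algebra.Bundles using (CommutativeRing)

-- Permutations of [m] are encoded as lists s = [σ(1), …, σ(m)]
-- (1-indexed values; positions also 1-indexed via `ap`).

nth : List ℕ → ℕ → ℕ
nth []       _       = 0
nth (x ∷ xs) zero    = x
nth (x ∷ xs) (suc i) = nth xs i

ap : List ℕ → ℕ → ℕ
ap s i = nth s (i ∸ 1)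

range : ℕ → List ℕ
range m = map suc (upTo m)

count : (ℕ → Bool) → List ℕ → ℕ
count p []       = 0
count p (x ∷ xs) = if p x then suc (count p xs) else count p xs

firstWith : (ℕ → Bool) → List ℕ → ℕ
firstWith p []       = 0
firstWith p (x ∷ xs) = if p x then x else firstWith p xs

inv : List ℕ → ℕ → ℕ
inv s i = firstWith (λ j → ap s j ≡ᵇ i) (range (length s))

iter : List ℕ → ℕ → ℕ → ℕ
iter s zero    i = i
iter s (suc k) i = ap s (iter s k i)

words : ℕ → ℕ → List (List ℕ)
words m zero    = [] ∷ []
words m (suc k) = concatMap (λ w → map (λ a → a ∷ w) (range m)) (words m k)

notElem : ℕ → List ℕ → Bool
notElem a []       = true
notElem a (x ∷ xs) = not (a ≡ᵇ x) ∧ notElem a xs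

distinct : List ℕ → Bool
distinct []       = true
distinct (x ∷ xs) = notElem x xs ∧ distinct xs

isOdd : ℕ → Bool
isOdd i = (i % 2) ≡ᵇ 1

isEven : ℕ → Bool
isEven i = (i % 2) ≡ᵇ 0

dCond : List ℕ → Bool
dCond s = all (λ i → if isOdd i then i ≤ᵇ ap s i else ap s i ≤ᵇ i) (range (length s))

-- 𝔇_{2n} as a list of permutations of [2n] (each exactly once)
D : ℕ → List (List ℕ)
D n = filterᵇ (λ s → distinct s ∧ dCond s) (words (2 ℕ.* n) (2 ℕ.* n))

isRecord : List ℕ → ℕ → Bool
isRecord s i = all (λ j → ap s j <ᵇ ap s i) (range (i ∸ 1))

isAntirecord : List ℕ → ℕ → Bool
isAntirecord s i = all (λ j → ap s i <ᵇ ap s j) (filterᵇ (λ j → i <ᵇ j) (range (length s)))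

exclRec exclArec recArec neitherRA : List ℕ → ℕ → Bool
exclRec   s i = isRecord s i ∧ not (isAntirecord s i)
exclArec  s i = isAntirecord s i ∧ not (isRecord s i)
recArec   s i = isRecord s i ∧ isAntirecord s i
neitherRA s i = not (isRecord s i) ∧ not (isAntirecord s i)

cpeak cval cdrise cdfall fixp : List ℕ → ℕ → Bool
cpeak  s i = (inv s i <ᵇ i) ∧ (ap s i <ᵇ i)
cval   s i = (i <ᵇ inv s i) ∧ (i <ᵇ ap s i)
cdrise s i = (inv s i <ᵇ i) ∧ (i <ᵇ ap s i)
cdfall s i = (i <ᵇ inv s i) ∧ (ap s i <ᵇ i)
fixp   s i = ap s i ≡ᵇ i

cnt : (List ℕ → ℕ → Bool) → List ℕ → ℕ
cnt p s = count (p s) (range (length s))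

eareccpeak eareccdfall ereccval ereccdrise′ : List ℕ → ℕ
eareccpeak  = cnt (λ s i → exclArec s i ∧ cpeak s i)
eareccdfall = cnt (λ s i → exclArec s i ∧ cdfall s i)
ereccval    = cnt (λ s i → exclRec s i ∧ cval s i)
ereccdrise′ = cnt (λ s i → cdrise s i ∧ isRecord s (inv s i))

nrcpeak nrcdfall nrcval nrcdrise′ : List ℕ → ℕ
nrcpeak   = cnt (λ s i → neitherRA s i ∧ cpeak s i)
nrcdfall  = cnt (λ s i → neitherRA s i ∧ cdfall s i)
nrcval    = cnt (λ s i → neitherRA s i ∧ cval s i)
nrcdrise′ = cnt (λ s i → cdrise s i ∧ not (isRecord s (inv s i)))

evennrfix oddnrfix evenrar oddrar : List ℕ → ℕ
evennrfix = cnt (λ s i → isEven i ∧ fixp s i ∧ neitherRA s i)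
oddnrfix  = cnt (λ s i → isOdd i ∧ fixp s i ∧ neitherRA s i)
evenrar   = cnt (λ s i → isEven i ∧ recArec s i)
oddrar    = cnt (λ s i → isOdd i ∧ recArec s i)

-- number of cycles = number of i that are the minimum of their cycle
cyc : List ℕ → ℕ
cyc = cnt (λ s i → all (λ k → i ≤ᵇ iter s k i) (upTo (length s)))

module WithRing {c ℓ} (R : CommutativeRing c ℓ) where
  open CommutativeRing R

  pow : Carrier → ℕ → Carrier
  pow x zero    = 1#
  pow x (suc n) = x * pow x n

  nat : ℕ → Carrier
  nat zero    = 0#
  nat (suc n) = 1# + nat n

  sumL : List Carrier → Carrier
  sumL = foldr _+_ 0#

  Pnn : (x₁ x₂ y₁ ŷ₂ u₁ u₂ v₁ v̂₂ wₑ wₒ zₑ zₒ λ′ : Carrier) → ℕ → Carrier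
  Pnn x₁ x₂ y₁ ŷ₂ u₁ u₂ v₁ v̂₂ wₑ wₒ zₑ zₒ λ′ n =
    sumL (map (λ σ →
        pow x₁ (eareccpeak σ) * pow x₂ (eareccdfall σ)
      * pow y₁ (ereccval σ)   * pow ŷ₂ (ereccdrise′ σ)
      * pow u₁ (nrcpeak σ)    * pow u₂ (nrcdfall σ)
      * pow v₁ (nrcval σ)     * pow v̂₂ (nrcdrise′ σ)
      * pow wₑ (evennrfix σ)  * pow wₒ (oddnrfix σ)
      * pow zₑ (evenrar σ)    * pow zₒ (oddrar σ)
      * pow λ′ (cyc σ)) (D n))

  Series : Set c
  Series = ℕ → Carrier

  one : Series
  one zero    = 1#
  one (suc _) = 0#

  shiftT : Series → Series
  shiftT f zero    = 0#
  shiftT f (suc n) = f n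

  conv : Series → ℕ → List Carrier → Carrier
  conv g k []       = 0#
  conv g k (h ∷ hs) = g k * h + conv g (suc k) hs

  -- reversed prefix [h_n, …, h_0] of h = 1/(1 - g), for g with g(0) = 0:
  -- h_0 = 1, h_{n+1} = Σ_{k=1}^{n+1} g_k h_{n+1-k}
  geomPrefix : Series → ℕ → List Carrier
  geomPrefix g zero    = 1# ∷ []
  geomPrefix g (suc n) = conv g 1 (geomPrefix g n) ∷ geomPrefix g n

  headOr0 : List Carrier → Carrier
  headOr0 []      = 0#
  headOr0 (x ∷ _) = x

  -- 1/(1 - g) (g with zero constant term)
  geom : Series → Series
  geom g n = headOr0 (geomPrefix g n)

  cfFrom : (α δ : ℕ → Carrier) → ℕ → ℕ → Series
  cfFrom α δ zero    k = one
  cfFrom α δ (suc d) k =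
    geom (shiftT (λ m → δ k * one m + α k * cfFrom α δ d (suc k) m))

  -- T-type continued fraction 1/(1-δ₁t-α₁t/(1-δ₂t-α₂t/(1-⋯))):
  -- its t^n coefficient is that of any truncation of depth ≥ n+1
  Tfrac : (α δ : ℕ → Carrier) → Series
  Tfrac α δ n = cfFrom α δ (suc n) 1 n

  -- the coefficients of Theorem 4.2 (index j ≥ 1; j = 2k-1 or j = 2k, k = ⌈j/2⌉)
  alpha42 : (x₁ x₂ y₁ ŷ₂ u₁ u₂ v̂₂ wₑ wₒ λ′ : Carrier) → ℕ → Carrier
  alpha42 x₁ x₂ y₁ ŷ₂ u₁ u₂ v̂₂ wₑ wₒ λ′ j =
    if isOdd j
    then (λ′ + nat (k ∸ 1)) * (x₁ + nat (k ∸ 1) * u₁) * y₁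
    else (x₂ + nat (k ∸ 1) * u₂ + λ′ * wₑ) * (ŷ₂ + nat (k ∸ 1) * v̂₂ + λ′ * wₒ)
    where k = (j ℕ.+ 1) / 2

  delta42 : (zₑ zₒ λ′ : Carrier) → ℕ → Carrier
  delta42 zₑ zₒ λ′ (suc zero) = λ′ * λ′ * zₑ * zₒ
  delta42 zₑ zₒ λ′ _          = 0#

{-# OPTIONS --safe #-}
module Submission where

-- Scan the positions 1, 2, …, 2n of a D-permutation σ. After i positions the arcs of σ inside [1, i]
-- form cycles and k open paths; V and S are the sets of the k initial and the k final points of
-- these paths. An odd position either starts a new path (cycle valley, weight y₁), or prolongs a
-- path at an s ∈ S (cycle double rise; s is a record iff it is the least element of S), or is a fixed
-- point. An even position either joins s ∈ S to v ∈ V (cycle peak, closing a cycle for exactly one of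
-- the k choices of s), or prolongs a path at v ∈ V (cycle double fall), or is fixed; in the first two
-- cases it is an antirecord iff v is the least element of V. So the weight of a step depends on k
-- only after summing over the choices, which gives a transfer recursion for Dyck-like paths, and the
-- continued fraction follows by cutting the paths at their first descents to each height. The cycles
-- get counted at their maxima, whereas cyc counts minima.

open import Defs
open import Algebra.Bundles using (CommutativeRing; CommutativeSemiring)
open import Data.Bool using (Bool; true; false; if_then_else_; T; _∧_; not)
open import Data.Bool.Properties using (T?)
open import Data.Fin as Fin using (Fin; toℕ; fromℕ<)
open import Data.Fin.Patterns using (0F; 1F; 2F; 3F; 4F; 5F; 6F; 7F; 8F; 9F)
import Data.Fin.Properties as Fin
open import Data.List
  using (List; []; _∷_; map; foldr; length; upTo; applyUpTo; filter; cartesianProductWith; concatMap; _++_; _∷ʳ_)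
open import Data.List.Membership.Propositional using (_∈_; _∉_; find; lose)
open import Data.List.Membership.Propositional.Properties
  using (∈-map⁺; ∈-map⁻; ∈-upTo⁺; ∈-upTo⁻; ∈-filter⁺; ∈-filter⁻; ∈-++⁻; ∈-++⁺ˡ; ∈-++⁺ʳ;
         ∈-cartesianProductWith⁺; ∈-cartesianProductWith⁻)
import Data.List.Properties as List
open import Data.List.Relation.Unary.All as All using (All; []; _∷_)
open import Data.List.Relation.Unary.AllPairs as AllPairs using (AllPairs; []; _∷_)
import Data.List.Relation.Unary.AllPairs.Properties as AllPairs
open import Data.List.Relation.Unary.Any using (here; there; any?)
open import Data.List.Relation.Unary.Unique.Propositional using (Unique)
import Data.List.Relation.Unary.Unique.Propositional.Properties as Unique
open import Data.Nat as ℕ using (ℕ; zero; suc; z≤n; s≤s; _∸_; _≤_; _<_; _≡ᵇ_; _<ᵇ_; _≤ᵇ_)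
import Data.Nat.DivMod as ℕ
import Data.Nat.Properties as ℕ
open import Data.Product using (_,_; _×_; ∃; proj₁; proj₂)
open import Data.Sum using (_⊎_; inj₁; inj₂; [_,_])
open import Data.Vec using (Vec; []; _∷_)
open import Function using (_∘_; id; flip)
open import Relation.Binary.PropositionalEquality as ≡ using (_≡_; _≢_)
open import Relation.Nullary using (¬_; yes; no; contradiction; Dec; does; proof; ¬?)
open import Relation.Nullary.Reflects
  using (Reflects; ofʸ; ofⁿ; det; fromEquivalence; _×-reflects_; ¬-reflects)

-- No bijection with labelled paths is built. A partial map is tested against each σ in `D n` by a
-- Boolean, and the sum over `D n` is split by these indicators at every position: if σ agrees with
-- the partial map so far, it agrees with exactly one of the moves that the position allows. The
-- specialisation v₁ = y₁ comes from the direction of the scan. At a valley i neither σ(i) nor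
-- σ⁻¹(i) is known, so nothing decides yet whether i is a record, and both outcomes must weigh the
-- same. A double rise i has an unknown σ(i) too, and is therefore judged by the record status of
-- σ⁻¹(i), whose image i gets fixed at that moment. Peaks and falls have a known σ(i), and whether
-- they are antirecords can be read off from the values still missing. The factor λ is due when a
-- cycle closes, which happens at its maximum; at its minimum it is still open which paths will
-- later be joined into the same cycle.

module FiniteSums {c ℓ} (R : CommutativeSemiring c ℓ) where
  open CommutativeSemiring R
  open import Algebra.Properties.CommutativeSemigroup +-commutativeSemigroup using () renaming (interchange to +-interchange)
  open import Algebra.Properties.CommutativeSemigroup *-commutativeSemigroup using () renaming (interchange to *-interchange)

  ∑ ∏ : {A : Set} → List A → (A → Carrier) → Carrier
  ∑ L f = foldr _+_ 0# (map f L)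
  ∏ L f = foldr _*_ 1# (map f L)

  -- Iverson bracket. It is used over the natural numbers for double counting and over the ring for
  -- the test of agreement, hence the generality of a commutative semiring.
  ⟦_⟧ : Bool → Carrier
  ⟦ b ⟧ = if b then 1# else 0#

  module _ {A : Set} where

    ∑-cong : ∀ (L : List A) {f g : A → Carrier} → (∀ {x} → x ∈ L → f x ≈ g x) → ∑ L f ≈ ∑ L g
    ∑-cong []      e = refl
    ∑-cong (x ∷ L) e = +-cong (e (here ≡.refl)) (∑-cong L (e ∘ there))

    ∑-zero : ∀ (L : List A) {f : A → Carrier} → (∀ {x} → x ∈ L → f x ≈ 0#) → ∑ L f ≈ 0#
    ∑-zero []      e = refl
    ∑-zero (x ∷ L) e = trans (+-cong (e (here ≡.refl)) (∑-zero L (e ∘ there))) (+-identityˡ 0#)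

    ∑-+ : ∀ (L : List A) (f g : A → Carrier) → ∑ L (λ x → f x + g x) ≈ ∑ L f + ∑ L g
    ∑-+ []      f g = sym (+-identityˡ 0#)
    ∑-+ (x ∷ L) f g = trans (+-congˡ (∑-+ L f g)) (+-interchange _ _ _ _)

    ∏-* : ∀ (L : List A) (f g : A → Carrier) → ∏ L (λ x → f x * g x) ≈ ∏ L f * ∏ L g
    ∏-* []      f g = sym (*-identityˡ 1#)
    ∏-* (x ∷ L) f g = trans (*-congˡ (∏-* L f g)) (*-interchange _ _ _ _)

    ∑-*ˡ : ∀ (L : List A) a (f : A → Carrier) → ∑ L (λ x → a * f x) ≈ a * ∑ L f
    ∑-*ˡ []      a f = sym (zeroʳ a)
    ∑-*ˡ (x ∷ L) a f = trans (+-congˡ (∑-*ˡ L a f)) (sym (distribˡ a _ _))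

    ∑-*ʳ : ∀ (L : List A) a (f : A → Carrier) → ∑ L (λ x → f x * a) ≈ ∑ L f * a
    ∑-*ʳ []      a f = sym (zeroˡ a)
    ∑-*ʳ (x ∷ L) a f = trans (+-congˡ (∑-*ʳ L a f)) (sym (distribʳ a _ _))

    ∑-single : ∀ {L : List A} {f : A → Carrier} {x} → Unique L → x ∈ L →
               (∀ {y} → y ∈ L → y ≢ x → f y ≈ 0#) → ∑ L f ≈ f x
    ∑-single {L = _ ∷ L} (x∉ ∷ _) (here ≡.refl) z =
      trans (+-congˡ (∑-zero L λ y∈ → z (there y∈) (λ y≡x → All.lookup x∉ y∈ (≡.sym y≡x)))) (+-identityʳ _)
    ∑-single (x∉ ∷ u) (there x∈) z =
      trans (+-cong (z (here ≡.refl) (All.lookup x∉ x∈)) (∑-single u x∈ (z ∘ there))) (+-identityˡ _)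

  ∑-swap : ∀ {A B : Set} (L : List A) (M : List B) (f : A → B → Carrier) →
           ∑ L (λ x → ∑ M (f x)) ≈ ∑ M (λ y → ∑ L (λ x → f x y))
  ∑-swap []      M f = sym (∑-zero M (λ _ → refl))
  ∑-swap (x ∷ L) M f = trans (+-congˡ (∑-swap L M f)) (sym (∑-+ M (f x) _))

-- Boolean tests as propositions, and `D n` as a list of words

module DPermutations where
  open ≡ using (refl; sym; trans; cong; subst; module ≡-Reasoning)

  module _ {a} {A : Set a} where

    reflects-true : ∀ {b} → Reflects A b → A → b ≡ true
    reflects-true r x = det r (ofʸ x)

    reflects-false : ∀ {b} → Reflects A b → ¬ A → b ≡ false
    reflects-false r ¬x = det r (ofⁿ ¬x)

    reflects-sound : ∀ {b} → Reflects A b → b ≡ true → A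
    reflects-sound (ofʸ x) refl = x

    reflects-map : ∀ {b} {B : Set} → (A → B) → (B → A) → Reflects A b → Reflects B b
    reflects-map f g (ofʸ x)  = ofʸ (f x)
    reflects-map f g (ofⁿ ¬x) = ofⁿ (¬x ∘ g)

  ≡ᵇ-reflects-≡ : ∀ m n → Reflects (m ≡ n) (m ≡ᵇ n)
  ≡ᵇ-reflects-≡ m n = fromEquivalence (ℕ.≡ᵇ⇒≡ m n) (ℕ.≡⇒≡ᵇ m n)

  ≡ᵇ-refl : ∀ m → (m ≡ᵇ m) ≡ true
  ≡ᵇ-refl m = reflects-true (≡ᵇ-reflects-≡ m m) refl

  ≢⇒≡ᵇ : ∀ {m n} → m ≢ n → (m ≡ᵇ n) ≡ false
  ≢⇒≡ᵇ = reflects-false (≡ᵇ-reflects-≡ _ _)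

  <⇒<ᵇ : ∀ {m n} → m < n → (m <ᵇ n) ≡ true
  <⇒<ᵇ = reflects-true (ℕ.<ᵇ-reflects-< _ _)

  ≤⇒<ᵇ : ∀ {m n} → n ≤ m → (m <ᵇ n) ≡ false
  ≤⇒<ᵇ n≤m = reflects-false (ℕ.<ᵇ-reflects-< _ _) (ℕ.≤⇒≯ n≤m)

  all-reflects : ∀ {A : Set} {P : A → Set} {p} (L : List A) → (∀ x → Reflects (P x) (p x)) →
                 Reflects (∀ x → x ∈ L → P x) (all p L)
  all-reflects []      r = ofʸ λ _ ()
  all-reflects (x ∷ L) r = reflects-map
    (λ { (px , pL) _ (here refl) → px ; (px , pL) _ (there x∈) → pL _ x∈ })
    (λ h → h _ (here refl) , λ _ → h _ ∘ there)
    (r x ×-reflects all-reflects L r)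

  infix 4 _within_
  _within_ : ℕ → ℕ → Set
  j within m = 1 ≤ j × j ≤ m

  ∈-range⁺ : ∀ {m j} → j within m → j ∈ range m
  ∈-range⁺ {j = suc j} (_ , j<m) = ∈-map⁺ suc (∈-upTo⁺ j<m)

  ∈-range⁻ : ∀ {m j} → j ∈ range m → j within m
  ∈-range⁻ j∈ with _ , i∈ , refl ← ∈-map⁻ suc j∈ = s≤s z≤n , ∈-upTo⁻ i∈

  range-unique : ∀ m → Unique (range m)
  range-unique m = Unique.map⁺ ℕ.suc-injective (Unique.upTo⁺ m)

  all-range-reflects : ∀ {P : ℕ → Set} {p} m → (∀ x → Reflects (P x) (p x)) →
                       Reflects (∀ j → j within m → P j) (all p (range m))
  all-range-reflects m r = reflects-map (λ h j j≤ → h j (∈-range⁺ j≤)) (λ h j j∈ → h j (∈-range⁻ j∈))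
                                        (all-reflects (range m) r)

  nth-map-applyUpTo : ∀ {A : Set} (f : A → ℕ) (g : ℕ → A) {m j} → j < m → nth (map f (applyUpTo g m)) j ≡ f (g j)
  nth-map-applyUpTo f g {suc m} {zero}  _         = refl
  nth-map-applyUpTo f g {suc m} {suc j} (s≤s j<m) = nth-map-applyUpTo f (g ∘ suc) j<m

  -- Inverse to `ap`. At the end of the scan the completed partial map has to become a list again,
  -- as a member of `D n`.
  word : ℕ → (ℕ → ℕ) → List ℕ
  word m f = map f (range m)

  length-range : ∀ m → length (range m) ≡ m
  length-range m = trans (List.length-map suc (upTo m)) (List.length-upTo m)

  length-word : ∀ m f → length (word m f) ≡ m
  length-word m f = trans (List.length-map f (range m)) (length-range m)

  word≡map-upTo : ∀ m f → word m f ≡ map (f ∘ suc) (upTo m)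
  word≡map-upTo m f = sym (List.map-∘ (upTo m))

  ap-word : ∀ {m} f {j} → j within m → ap (word m f) j ≡ f j
  ap-word {m} f {suc j} (_ , j<m) = trans (cong (λ s → nth s j) (word≡map-upTo m f)) (nth-map-applyUpTo (f ∘ suc) id j<m)

  map-nth-upTo : ∀ s → map (nth s) (upTo (length s)) ≡ s
  map-nth-upTo s = trans (List.map-applyUpTo id (nth s) (length s)) (go s)
    where
    go : ∀ s → applyUpTo (nth s) (length s) ≡ s
    go []      = refl
    go (x ∷ s) = cong (x ∷_) (go s)

  word-ap : ∀ s → word (length s) (ap s) ≡ s
  word-ap s = trans (word≡map-upTo (length s) (ap s)) (map-nth-upTo s)

  word-cong : ∀ {m f g} → (∀ j → j within m → f j ≡ g j) → word m f ≡ word m g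
  word-cong {m} h = List.map-cong-local (All.tabulate (λ j∈ → h _ (∈-range⁻ j∈)))

  notElem-reflects : ∀ a L → Reflects (a ∉ L) (notElem a L)
  notElem-reflects a []      = ofʸ λ ()
  notElem-reflects a (x ∷ L) = reflects-map
    (λ { (a≢x , a∉L) (here e) → a≢x e ; (a≢x , a∉L) (there a∈) → a∉L a∈ })
    (λ h → h ∘ here , h ∘ there)
    (¬-reflects (≡ᵇ-reflects-≡ a x) ×-reflects notElem-reflects a L)

  distinct-reflects : ∀ L → Reflects (Unique L) (distinct L)
  distinct-reflects []      = ofʸ []
  distinct-reflects (x ∷ L) = reflects-map
    (λ { (x∉ , u) → All.tabulate (λ { y∈ refl → x∉ y∈ }) ∷ u })
    (λ { (x∉ ∷ u) → (λ x∈ → All.lookup x∉ x∈ refl) , u })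
    (notElem-reflects x L ×-reflects distinct-reflects L)

  nth-∈ : ∀ s {j} → j < length s → nth s j ∈ s
  nth-∈ (x ∷ s) {zero}  _         = here refl
  nth-∈ (x ∷ s) {suc j} (s≤s j<) = there (nth-∈ s j<)

  nth-injective : ∀ {s i j} → Unique s → i < length s → j < length s → nth s i ≡ nth s j → i ≡ j
  nth-injective {x ∷ s} {zero}  {zero}  _        _        _        _ = refl
  nth-injective {x ∷ s} {zero}  {suc j} (x∉ ∷ _) _        (s≤s j<) e = contradiction e (All.lookup x∉ (nth-∈ s j<))
  nth-injective {x ∷ s} {suc i} {zero}  (x∉ ∷ _) (s≤s i<) _        e = contradiction (sym e) (All.lookup x∉ (nth-∈ s i<))
  nth-injective {x ∷ s} {suc i} {suc j} (_ ∷ u)  (s≤s i<) (s≤s j<) e = cong suc (nth-injective u i< j< e)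

  -- Makes membership and uniqueness in `words` instances of the corresponding facts on cartesian
  -- products.
  concatMap-cartesian : ∀ {A B C : Set} (f : A → B → C) xs ys → concatMap (λ x → map (f x) ys) xs ≡ cartesianProductWith f xs ys
  concatMap-cartesian f []       ys = refl
  concatMap-cartesian f (x ∷ xs) ys = cong (map (f x) ys ++_) (concatMap-cartesian f xs ys)

  words-suc : ∀ m k → words m (suc k) ≡ cartesianProductWith (λ w a → a ∷ w) (words m k) (range m)
  words-suc m k = concatMap-cartesian (λ w a → a ∷ w) (words m k) (range m)

  words-unique : ∀ m k → Unique (words m k)
  words-unique m zero    = [] ∷ []
  words-unique m (suc k) = subst Unique (sym (words-suc m k))
    (Unique.cartesianProductWith⁺ _ (λ e → List.∷-injectiveʳ e , List.∷-injectiveˡ e) (words-unique m k) (range-unique m))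

  ∈-words⁻ : ∀ m k {s} → s ∈ words m k → length s ≡ k × All (_within m) s
  ∈-words⁻ m zero    (here refl) = refl , []
  ∈-words⁻ m (suc k) s∈
    with w , a , w∈ , a∈ , refl ← ∈-cartesianProductWith⁻ (λ w a → a ∷ w) (words m k) (range m) (subst (_ ∈_) (words-suc m k) s∈)
    = let len , ws = ∈-words⁻ m k w∈ in cong suc len , ∈-range⁻ a∈ ∷ ws

  ∈-words⁺ : ∀ m {s} → All (_within m) s → s ∈ words m (length s)
  ∈-words⁺ m []       = here refl
  ∈-words⁺ m {a ∷ s} (a∈ ∷ s∈) = subst (a ∷ s ∈_) (sym (words-suc m (length s)))
    (∈-cartesianProductWith⁺ (λ w a → a ∷ w) (∈-words⁺ m s∈) (∈-range⁺ a∈))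

  record IsDPermutation (N : ℕ) (f : ℕ → ℕ) : Set where
    field
      maps      : ∀ {j} → j within N → f j within N
      injective : ∀ {i j} → i within N → j within N → f i ≡ f j → i ≡ j
      odd-≤     : ∀ {j} → j within N → isOdd j ≡ true → j ≤ f j
      even-≥    : ∀ {j} → j within N → isOdd j ≡ false → f j ≤ j

  dCond-reflects : ∀ s → Reflects (∀ j → j within length s → (isOdd j ≡ true → j ≤ ap s j) × (isOdd j ≡ false → ap s j ≤ j)) (dCond s)
  dCond-reflects s = all-range-reflects (length s) at
    where
    at : ∀ j → Reflects ((isOdd j ≡ true → j ≤ ap s j) × (isOdd j ≡ false → ap s j ≤ j))
                        (if isOdd j then j ≤ᵇ ap s j else ap s j ≤ᵇ j)
    at j with isOdd j
    ... | true  = reflects-map (λ h → (λ _ → h) , λ ()) (λ h → proj₁ h refl) (ℕ.≤ᵇ-reflects-≤ j (ap s j))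
    ... | false = reflects-map (λ h → (λ ()) , λ _ → h) (λ h → proj₂ h refl) (ℕ.≤ᵇ-reflects-≤ (ap s j) j)

  pred-< : ∀ {j m} → j within m → j ∸ 1 < m
  pred-< {suc j} (_ , j<m) = j<m

  ∈-D⁻ : ∀ n {s} → s ∈ D n → length s ≡ 2 ℕ.* n × IsDPermutation (2 ℕ.* n) (ap s)
  ∈-D⁻ n {s} s∈ with ∈-filter⁻ (T? ∘ λ s → distinct s ∧ dCond s) {xs = words (2 ℕ.* n) (2 ℕ.* n)} s∈
  ... | s∈words , Ps with ∈-words⁻ _ _ s∈words
  ... | len , range-s = len , record
    { maps      = λ j∈ → All.lookup range-s (nth-∈ s (subst (_ <_) (sym len) (pred-< j∈)))
    ; injective = λ { {suc i} {suc j} i∈ j∈ e →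
                      cong suc (nth-injective (proj₁ props) (subst (_ <_) (sym len) (pred-< i∈)) (subst (_ <_) (sym len) (pred-< j∈)) e) }
    ; odd-≤     = λ j∈ → proj₁ (proj₂ props _ (subst (_ within_) (sym len) j∈))
    ; even-≥    = λ j∈ → proj₂ (proj₂ props _ (subst (_ within_) (sym len) j∈))
    }
    where
    T⇒≡ : ∀ {b} → T b → b ≡ true
    T⇒≡ {true} _ = refl
    props = reflects-sound (distinct-reflects s ×-reflects dCond-reflects s) (T⇒≡ Ps)

  word-∈-D : ∀ n {f} → IsDPermutation (2 ℕ.* n) f → word (2 ℕ.* n) f ∈ D n
  word-∈-D n {f} perm = ∈-filter⁺ (T? ∘ λ s → distinct s ∧ dCond s)
    (subst (λ k → w ∈ words N k) (length-word N f)
      (∈-words⁺ N (All.tabulate (λ x∈ → let j , j∈ , e = ∈-map⁻ f x∈ in subst (_within N) (sym e) (maps (∈-range⁻ j∈))))))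
    (subst T (sym (reflects-true (distinct-reflects w ×-reflects dCond-reflects w) (unique , cond))) _)
    where
    open IsDPermutation perm
    N = 2 ℕ.* n
    w = word N f
    unique : Unique w
    unique = AllPairs.map⁺ (AllPairs.map⁺ (AllPairs.applyUpTo⁺₁ id N λ i<j j<N e →
      ℕ.<⇒≢ (s≤s i<j) (injective (s≤s z≤n , ℕ.<-trans i<j j<N) (s≤s z≤n , j<N) e)))
    cond : ∀ j → j within length w → (isOdd j ≡ true → j ≤ ap w j) × (isOdd j ≡ false → ap w j ≤ j)
    cond j j∈′ = (λ o → subst (j ≤_) (sym (ap-word f j∈)) (odd-≤ j∈ o)) ,
                 (λ e → subst (_≤ j) (sym (ap-word f j∈)) (even-≥ j∈ e))
      where j∈ = subst (j within_) (length-word N f) j∈′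

  D-unique : ∀ n → Unique (D n)
  D-unique n = Unique.filter⁺ (T? ∘ λ s → distinct s ∧ dCond s) (words-unique (2 ℕ.* n) (2 ℕ.* n))

  -- Pigeonhole principle, double counting and cycles

  module Pigeonhole {N : ℕ} {f : ℕ → ℕ} (maps : ∀ {j} → j within N → f j within N)
                    (injective : ∀ {i j} → i within N → j within N → f i ≡ f j → i ≡ j) where

    index : ∀ {j} → j within N → Fin N
    index j∈ = fromℕ< (pred-< j∈)

    index-injective : ∀ {i j} (i∈ : i within N) (j∈ : j within N) → index i∈ ≡ index j∈ → i ≡ j
    index-injective {suc i} {suc j} i∈ j∈ e =
      cong suc (trans (sym (Fin.toℕ-fromℕ< _)) (trans (cong toℕ e) (Fin.toℕ-fromℕ< _)))

    collision : ∀ {M} → N < M → (g : ℕ → ℕ) → (∀ {j} → j < M → g j within N) →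
                ∃ λ i → ∃ λ j → i < j × j < M × g i ≡ g j
    collision N<M g g∈ with Fin.pigeonhole N<M (λ k → index (g∈ (Fin.toℕ<n k)))
    ... | i , j , i<j , e = toℕ i , toℕ j , i<j , Fin.toℕ<n j , index-injective (g∈ (Fin.toℕ<n i)) (g∈ (Fin.toℕ<n j)) e

    -- Two of the N + 1 values v, f 1, ..., f N in [1, N] coincide; since f is injective, v is one
    -- of the two. The function `g` lists v at index 0.
    surjective : ∀ {v} → v within N → ∃ λ j → j within N × f j ≡ v
    surjective {v} v∈ = preimage (collision {suc N} ℕ.≤-refl g g∈)
      where
      g : ℕ → ℕ
      g zero    = v
      g (suc j) = f (suc j)
      g∈ : ∀ {j} → j < suc N → g j within N
      g∈ {zero}  _         = v∈
      g∈ {suc j} (s≤s j<N) = maps (s≤s z≤n , j<N)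
      preimage : (∃ λ i → ∃ λ j → i < j × j < suc N × g i ≡ g j) → ∃ λ j → j within N × f j ≡ v
      preimage (zero  , suc j , _   , s≤s j<N , e) = suc j , (s≤s z≤n , j<N) , sym e
      preimage (suc i , suc j , s≤s i<j , s≤s j<N , e) = contradiction
        (injective (s≤s z≤n , ℕ.<⇒≤ (ℕ.≤-<-trans i<j j<N)) (s≤s z≤n , j<N) e) (ℕ.<⇒≢ (s≤s i<j))

  all-upTo-reflects : ∀ {P : ℕ → Set} {p} m → (∀ x → Reflects (P x) (p x)) →
                      Reflects (∀ k → k < m → P k) (all p (upTo m))
  all-upTo-reflects m r = reflects-map (λ h k k< → h k (∈-upTo⁺ k<)) (λ h k k∈ → h k (∈-upTo⁻ k∈))
                                       (all-reflects (upTo m) r)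

  firstWith-unique : ∀ p {L x} → x ∈ L → p x ≡ true → (∀ {y} → y ∈ L → p y ≡ true → y ≡ x) → firstWith p L ≡ x
  firstWith-unique p {y ∷ L} x∈ px u with p y in py
  ... | true = u (here refl) py
  firstWith-unique p {y ∷ L} (here refl) px u | false with () ← trans (sym px) py
  firstWith-unique p {y ∷ L} (there x∈)  px u | false = firstWith-unique p x∈ px (u ∘ there)

  module _ where
    open FiniteSums ℕ.+-*-commutativeSemiring

    count≡∑ : ∀ p L → count p L ≡ ∑ L (⟦_⟧ ∘ p)
    count≡∑ p []      = refl
    count≡∑ p (x ∷ L) with p x
    ... | true  = cong suc (count≡∑ p L)
    ... | false = count≡∑ p L

    ∑-⟦⟧-single : ∀ {L : List ℕ} (p : ℕ → Bool) → Unique L → ∀ {x} → x ∈ L → p x ≡ true →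
                  (∀ {y} → y ∈ L → p y ≡ true → y ≡ x) → ∑ L (⟦_⟧ ∘ p) ≡ 1
    ∑-⟦⟧-single p u x∈ px only = trans
      (∑-single u x∈ λ {y} y∈ y≢x → zero-at y (λ py → y≢x (only y∈ py)))
      (cong ⟦_⟧ px)
      where
      zero-at : ∀ y → p y ≢ true → ⟦ p y ⟧ ≡ 0
      zero-at y ¬py with p y
      ... | true  = contradiction refl ¬py
      ... | false = refl

    -- Double counting of the related pairs (i , j) with P i and Q j.
    count-correspondence : ∀ {L} (P Q : ℕ → Bool) (_~_ : ℕ → ℕ → Bool) → Unique L →
      (∀ {i} → i ∈ L → ∃ λ j → j ∈ L × (i ~ j) ∧ Q j ≡ true × (∀ {j′} → j′ ∈ L → (i ~ j′) ∧ Q j′ ≡ true → j′ ≡ j)) →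
      (∀ {j} → j ∈ L → ∃ λ i → i ∈ L × P i ∧ (i ~ j) ≡ true × (∀ {i′} → i′ ∈ L → P i′ ∧ (i′ ~ j) ≡ true → i′ ≡ i)) →
      count P L ≡ count Q L
    count-correspondence {L} P Q _~_ u toQ toP = begin
      count P L                                             ≡⟨ count≡∑ P L ⟩
      ∑ L (⟦_⟧ ∘ P)                                         ≡⟨ ∑-cong L row ⟨
      ∑ L (λ i → ∑ L (λ j → ⟦ P i ∧ ((i ~ j) ∧ Q j) ⟧))     ≡⟨ ∑-swap L L _ ⟩
      ∑ L (λ j → ∑ L (λ i → ⟦ P i ∧ ((i ~ j) ∧ Q j) ⟧))     ≡⟨ ∑-cong L column ⟩
      ∑ L (⟦_⟧ ∘ Q)                                         ≡⟨ count≡∑ Q L ⟨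
      count Q L                                             ∎
      where
      open ≡-Reasoning
      row : ∀ {i} → i ∈ L → ∑ L (λ j → ⟦ P i ∧ ((i ~ j) ∧ Q j) ⟧) ≡ ⟦ P i ⟧
      row {i} i∈ with P i
      ... | false = ∑-zero L (λ _ → refl)
      ... | true  = let _ , j∈ , Qj , only = toQ i∈ in ∑-⟦⟧-single _ u j∈ Qj only
      column : ∀ {j} → j ∈ L → ∑ L (λ i → ⟦ P i ∧ ((i ~ j) ∧ Q j) ⟧) ≡ ⟦ Q j ⟧
      column {j} j∈ with Q j
      ... | false = ∑-zero L (λ {i} _ → ∧-false (P i) (i ~ j))
        where
        ∧-false : ∀ a b → ⟦ a ∧ (b ∧ false) ⟧ ≡ 0
        ∧-false false b     = refl
        ∧-false true  false = refl
        ∧-false true  true  = refl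
      ... | true = trans (∑-cong L (λ {i} _ → cong (λ b → ⟦ P i ∧ b ⟧) (∧-true (i ~ j))))
                         (let _ , i∈ , Pi , only = toP j∈ in ∑-⟦⟧-single _ u i∈ Pi only)
        where
        ∧-true : ∀ b → b ∧ true ≡ b
        ∧-true false = refl
        ∧-true true  = refl

  cycMax : List ℕ → ℕ → Bool
  cycMax s i = all (λ k → iter s k i ≤ᵇ i) (upTo (length s))

  module Cycles (s : List ℕ) (maps : ∀ {j} → j within length s → ap s j within length s)
                (injective : ∀ {i j} → i within length s → j within length s → ap s i ≡ ap s j → i ≡ j) where

    N = length s
    open Pigeonhole maps injective public

    inv-ap : ∀ {j} → j within N → inv s (ap s j) ≡ j
    inv-ap {j} j∈ = firstWith-unique _ (∈-range⁺ j∈) (≡ᵇ-refl (ap s j))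
      (λ y∈ e → injective (∈-range⁻ y∈) j∈ (reflects-sound (≡ᵇ-reflects-≡ _ _) e))

    iter-within : ∀ k {i} → i within N → iter s k i within N
    iter-within zero    i∈ = i∈
    iter-within (suc k) i∈ = maps (iter-within k i∈)

    iter-+ : ∀ a b i → iter s (a ℕ.+ b) i ≡ iter s a (iter s b i)
    iter-+ zero    b i = refl
    iter-+ (suc a) b i = cong (ap s) (iter-+ a b i)

    iter-injective : ∀ k {i j} → i within N → j within N → iter s k i ≡ iter s k j → i ≡ j
    iter-injective zero    i∈ j∈ e = e
    iter-injective (suc k) i∈ j∈ e = iter-injective k i∈ j∈ (injective (iter-within k i∈) (iter-within k j∈) e)

    abstract
      -- Two of the N + 1 iterates of i with exponents 0, ..., N coincide, say those with exponents
      -- a < b. Cancelling a applications by injectivity leaves the return time b - a, which is at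
      -- most N.
      period : ∀ {i} → i within N → ∃ λ p → p < N × iter s (suc p) i ≡ i
      period {i} i∈ with collision {suc N} ℕ.≤-refl (λ k → iter s k i) (λ {k} _ → iter-within k i∈)
      ... | a , b , a<b , b<1+N , e with ℕ.m≤n⇒∃[o]m+o≡n a<b
      ...   | p , refl = p , ℕ.≤-trans (s≤s (ℕ.m≤n+m p a)) (ℕ.≤-pred b<1+N) ,
              sym (iter-injective a i∈ (iter-within (suc p) i∈) (trans e (trans (cong (λ k → iter s k i) (sym (ℕ.+-suc a p))) (iter-+ a (suc p) i))))

    iter-reduce : ∀ {i p} → iter s (suc p) i ≡ i → ∀ k → ∃ λ k′ → k′ ≤ p × iter s k i ≡ iter s k′ i
    iter-reduce per zero = 0 , z≤n , refl
    iter-reduce per (suc k) with iter-reduce per k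
    ... | k′ , k′≤p , e with ℕ.m≤n⇒m<n∨m≡n k′≤p
    ...   | inj₁ k′<p = suc k′ , k′<p , cong (ap s) e
    ...   | inj₂ refl = 0 , z≤n , trans (cong (ap s) e) per

    -- The tests in `cyc` and `cycMax` look only at the first N iterates. By periodicity these
    -- exhaust the cycle, so that the tests decide statements on all iterates.
    iter-bounded : ∀ {i} → i within N → ∀ k → ∃ λ k′ → k′ < N × iter s k i ≡ iter s k′ i
    iter-bounded i∈ k = let p , p<N , per = period i∈ ; k′ , k′≤p , e = iter-reduce per k in k′ , ℕ.≤-<-trans k′≤p p<N , e

    SameCycle : ℕ → ℕ → Set
    SameCycle i j = ∃ λ k → iter s k i ≡ j

    -- Reduce the exponent modulo the period, then walk the rest of the way round the cycle.
    SameCycle-sym : ∀ {i j} → i within N → SameCycle i j → SameCycle j i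
    SameCycle-sym {i} {j} i∈ (k , ek) =
      let p , _ , per = period i∈ ; k′ , k′≤p , e = iter-reduce per k ; o , eo = ℕ.m≤n⇒∃[o]m+o≡n k′≤p in
      return {p} {k′} {o} per (trans (sym e) ek) eo
      where
      return : ∀ {p k′ o} → iter s (suc p) i ≡ i → iter s k′ i ≡ j → k′ ℕ.+ o ≡ p → SameCycle j i
      return {p} {k′} {o} per e eo = suc o , (begin
        iter s (suc o) j               ≡⟨ cong (iter s (suc o)) e ⟨
        iter s (suc o) (iter s k′ i)   ≡⟨ iter-+ (suc o) k′ i ⟨
        iter s (suc o ℕ.+ k′) i        ≡⟨ cong (λ m → iter s (suc m) i) (trans (ℕ.+-comm o k′) eo) ⟩
        iter s (suc p) i               ≡⟨ per ⟩
        i                              ∎)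
        where open ≡-Reasoning

    SameCycle-trans : ∀ {i j k} → SameCycle i j → SameCycle j k → SameCycle i k
    SameCycle-trans {i} (a , refl) (b , refl) = b ℕ.+ a , iter-+ b a i

    sameCycle? : ∀ i j → Dec _
    sameCycle? i j = any? (λ k → iter s k i ℕ.≟ j) (upTo N)

    sameCycle : ℕ → ℕ → Bool
    sameCycle i j = does (sameCycle? i j)

    sameCycle-reflects : ∀ {i} j → i within N → Reflects (SameCycle i j) (sameCycle i j)
    sameCycle-reflects {i} j i∈ = reflects-map
      (λ a → let k , _ , e = find a in k , e)
      (λ { (k , refl) → let k′ , k′<N , e = iter-bounded i∈ k in lose (∈-upTo⁺ k′<N) (sym e) })
      (proof (sameCycle? i j))

    -- Minima and maxima of cycles at one stroke: the order is instantiated by ≤ and by its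
    -- opposite.
    module Extremal (_≼_ : ℕ → ℕ → Set) (le : ℕ → ℕ → Bool) (reflects : ∀ i j → Reflects (i ≼ j) (le i j))
                    (≼-refl : ∀ {i} → i ≼ i) (≼-trans : ∀ {i j k} → i ≼ j → j ≼ k → i ≼ k)
                    (≼-antisym : ∀ {i j} → i ≼ j → j ≼ i → i ≡ j) (≼-total : ∀ i j → i ≼ j ⊎ j ≼ i) where

      extreme : ℕ → Bool
      extreme i = all (λ k → le i (iter s k i)) (upTo N)

      extreme-reflects : ∀ {i} → i within N → Reflects (∀ k → i ≼ iter s k i) (extreme i)
      extreme-reflects {i} i∈ = reflects-map
        (λ h k → let k′ , k′<N , e = iter-bounded i∈ k in subst (i ≼_) (sym e) (h k′ k′<N))
        (λ h k _ → h k)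
        (all-upTo-reflects N (λ k → reflects i (iter s k i)))

      extremum : ∀ (g : ℕ → ℕ) n → ∃ λ m → ∀ k → k ≤ n → g m ≼ g k
      extremum g zero = 0 , λ { zero z≤n → ≼-refl }
      extremum g (suc n) with extremum g n
      ... | m , h with ≼-total (g m) (g (suc n))
      ...   | inj₁ below = m , λ k k≤ → case k (ℕ.m≤n⇒m<n∨m≡n k≤)
        where case : ∀ k → k < suc n ⊎ k ≡ suc n → g m ≼ g k
              case k (inj₁ (s≤s k≤n)) = h k k≤n
              case k (inj₂ refl)      = below
      ...   | inj₂ above = suc n , λ k k≤ → case k (ℕ.m≤n⇒m<n∨m≡n k≤)
        where case : ∀ k → k < suc n ⊎ k ≡ suc n → g (suc n) ≼ g k
              case k (inj₁ (s≤s k≤n)) = ≼-trans above (h k k≤n)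
              case k (inj₂ refl)      = ≼-refl

      extreme-exists : ∀ {i} → i within N → ∃ λ j → j within N × SameCycle i j × (∀ k → j ≼ iter s k j)
      extreme-exists {i} i∈ with extremum (λ k → iter s k i) N
      ... | m , h = iter s m i , iter-within m i∈ , (m , refl) , λ k →
        let k′ , k′<N , e = iter-bounded i∈ (k ℕ.+ m) in
        subst (iter s m i ≼_) (trans (sym e) (iter-+ k m i)) (h k′ (ℕ.<⇒≤ k′<N))

      extreme-unique : ∀ {i j} → SameCycle i j → SameCycle j i → (∀ k → i ≼ iter s k i) → (∀ k → j ≼ iter s k j) → i ≡ j
      extreme-unique {i} {j} (a , ea) (b , eb) hi hj = ≼-antisym (subst (i ≼_) ea (hi a)) (subst (j ≼_) eb (hj b))

    private
      module Min = Extremal _≤_ _≤ᵇ_ ℕ.≤ᵇ-reflects-≤ ℕ.≤-refl ℕ.≤-trans ℕ.≤-antisym ℕ.≤-total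
      module Max = Extremal (flip _≤_) (flip _≤ᵇ_) (flip ℕ.≤ᵇ-reflects-≤) ℕ.≤-refl (flip ℕ.≤-trans) (flip ℕ.≤-antisym) (flip ℕ.≤-total)

    cycMax-reflects : ∀ {i} → i within N → Reflects (∀ k → iter s k i ≤ i) (cycMax s i)
    cycMax-reflects = Max.extreme-reflects

    -- Minima and maxima are matched by lying on the same cycle: every point shares its cycle with
    -- exactly one maximum and exactly one minimum.
    cyc≡cnt-cycMax : cyc s ≡ cnt cycMax s
    cyc≡cnt-cycMax = count-correspondence Min.extreme Max.extreme sameCycle (range-unique N) toMax toMin
      where
      toMax : ∀ {i} → i ∈ range N → ∃ λ j → j ∈ range N × sameCycle i j ∧ Max.extreme j ≡ true ×
              (∀ {j′} → j′ ∈ range N → sameCycle i j′ ∧ Max.extreme j′ ≡ true → j′ ≡ j)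
      toMax i∈′ = let i∈ = ∈-range⁻ i∈′ ; j , j∈ , i~j , j-max = Max.extreme-exists i∈ in
        j , ∈-range⁺ j∈ , reflects-true (sameCycle-reflects j i∈ ×-reflects Max.extreme-reflects j∈) (i~j , j-max) ,
        λ {j′} j′∈ e → let i~j′ , j′-max = reflects-sound (sameCycle-reflects j′ i∈ ×-reflects Max.extreme-reflects (∈-range⁻ j′∈)) e in
          Max.extreme-unique (SameCycle-trans (SameCycle-sym i∈ i~j′) i~j) (SameCycle-trans (SameCycle-sym i∈ i~j) i~j′) j′-max j-max
      toMin : ∀ {j} → j ∈ range N → ∃ λ i → i ∈ range N × Min.extreme i ∧ sameCycle i j ≡ true ×
              (∀ {i′} → i′ ∈ range N → Min.extreme i′ ∧ sameCycle i′ j ≡ true → i′ ≡ i)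
      toMin {j} j∈′ = let j∈ = ∈-range⁻ j∈′ ; i , i∈ , j~i , i-min = Min.extreme-exists j∈ in
        i , ∈-range⁺ i∈ , reflects-true (Min.extreme-reflects i∈ ×-reflects sameCycle-reflects j i∈) (i-min , SameCycle-sym j∈ j~i) ,
        λ {i′} i′∈ e → let i′-min , i′~j = reflects-sound (Min.extreme-reflects (∈-range⁻ i′∈) ×-reflects sameCycle-reflects j (∈-range⁻ i′∈)) e in
          Min.extreme-unique (SameCycle-trans i′~j j~i) (SameCycle-trans (SameCycle-sym j∈ j~i) (SameCycle-sym (∈-range⁻ i′∈) i′~j)) i′-min i-min

  -- Partial permutations and their open paths

  infixl 10 _[_↦_]
  _[_↦_] : (ℕ → ℕ) → ℕ → ℕ → ℕ → ℕ
  (f [ a ↦ b ]) x = if x ≡ᵇ a then b else f x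

  [↦]-same : ∀ f a b → (f [ a ↦ b ]) a ≡ b
  [↦]-same f a b rewrite ≡ᵇ-refl a = refl

  [↦]-other : ∀ f {a b x} → x ≢ a → (f [ a ↦ b ]) x ≡ f x
  [↦]-other f x≢a rewrite ≢⇒≡ᵇ x≢a = refl

  infixl 6 _∖_
  _∖_ : List ℕ → ℕ → List ℕ
  L ∖ a = filter (λ x → ¬? (x ℕ.≟ a)) L

  ∈-∖⁺ : ∀ {L a x} → x ∈ L → x ≢ a → x ∈ L ∖ a
  ∈-∖⁺ = ∈-filter⁺ _

  ∈-∖⁻ : ∀ L {a x} → x ∈ L ∖ a → x ∈ L × x ≢ a
  ∈-∖⁻ L = ∈-filter⁻ _ {xs = L}

  length-∖ : ∀ {L a} → Unique L → a ∈ L → suc (length (L ∖ a)) ≡ length L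
  length-∖ {x ∷ L} {a} (x∉ ∷ u) (here refl) = cong (suc ∘ length)
    (trans (List.filter-reject (λ x → ¬? (x ℕ.≟ a)) (λ a≢a → a≢a refl))
           (List.filter-all (λ x → ¬? (x ℕ.≟ a)) (All.map (λ a≢y y≡a → a≢y (sym y≡a)) x∉)))
  length-∖ {x ∷ L} {a} (x∉ ∷ u) (there a∈) = cong suc
    (trans (cong length (List.filter-accept (λ x → ¬? (x ℕ.≟ a)) (All.lookup x∉ a∈))) (length-∖ u a∈))

  Sorted : List ℕ → Set
  Sorted = AllPairs _<_

  sorted⇒unique : ∀ {L} → Sorted L → Unique L
  sorted⇒unique = AllPairs.map ℕ.<⇒≢

  sorted-∷ʳ : ∀ {L t} → Sorted L → (∀ {x} → x ∈ L → x < t) → Sorted (L ∷ʳ t)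
  sorted-∷ʳ sorted below = AllPairs.++⁺ sorted ([] ∷ []) (All.tabulate (λ x∈ → below x∈ ∷ []))

  length-∷ʳ : ∀ (L : List ℕ) t → length (L ∷ʳ t) ≡ suc (length L)
  length-∷ʳ L t = trans (List.length-++ L) (ℕ.+-comm (length L) 1)

  ∈-∷ʳ⁻ : ∀ {x t : ℕ} L → x ∈ L ∷ʳ t → x ∈ L ⊎ x ≡ t
  ∈-∷ʳ⁻ L x∈ with ∈-++⁻ L x∈
  ... | inj₁ x∈L        = inj₁ x∈L
  ... | inj₂ (here x≡t) = inj₂ x≡t

  infixr 5 _◅_
  data Path (p : ℕ → ℕ) : ℕ → ℕ → Set where
    ε   : ∀ {x} → Path p x x
    _◅_ : ∀ {x y} → p x ≢ 0 → Path p (p x) y → Path p x y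

  _◅◅_ : ∀ {p x y z} → Path p x y → Path p y z → Path p x z
  ε       ◅◅ π = π
  (e ◅ ρ) ◅◅ π = e ◅ (ρ ◅◅ π)

  -- The arcs of a permutation with both ends in [1, i]: p j is the image of j, or 0 if that image
  -- exceeds i. These arcs form cycles and open paths; the latter start in the set V of the values
  -- not yet attained and end in the set S of the positions without image, the path from v ∈ V
  -- ending in E v.
  record State (i : ℕ) (p : ℕ → ℕ) (S V : List ℕ) (E : ℕ → ℕ) : Set where
    field
      support   : ∀ {j} → p j ≢ 0 → j within i
      bounded   : ∀ {j} → p j ≢ 0 → p j ≤ i
      injective : ∀ {a b} → p a ≢ 0 → p a ≡ p b → a ≡ b
      odd-≤     : ∀ {j} → p j ≢ 0 → isOdd j ≡ true → j ≤ p j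
      even-≥    : ∀ {j} → p j ≢ 0 → isOdd j ≡ false → p j ≤ j
      ∈S⁻       : ∀ {j} → j ∈ S → j within i × p j ≡ 0
      ∈S⁺       : ∀ {j} → j within i → p j ≡ 0 → j ∈ S
      ∈V⁻       : ∀ {v} → v ∈ V → v within i × (∀ j → p j ≢ v)
      ∈V⁺       : ∀ {v} → v within i → (∀ j → p j ≢ v) → v ∈ V
      S-sorted  : Sorted S
      V-sorted  : Sorted V
      balanced  : length S ≡ length V
      E∈S       : ∀ {v} → v ∈ V → E v ∈ S
      E-inj     : ∀ {v w} → v ∈ V → w ∈ V → E v ≡ E w → v ≡ w
      E-path    : ∀ {v} → v ∈ V → Path p v (E v)

  initial : State 0 (λ _ → 0) [] [] id
  initial = record
    { support = contradiction refl ; bounded = contradiction refl ; injective = contradiction refl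
    ; odd-≤ = contradiction refl ; even-≥ = contradiction refl
    ; ∈S⁻ = λ () ; ∈S⁺ = λ { (s≤s _ , ()) } ; ∈V⁻ = λ () ; ∈V⁺ = λ { (s≤s _ , ()) }
    ; S-sorted = [] ; V-sorted = [] ; balanced = refl
    ; E∈S = λ () ; E-inj = λ () ; E-path = λ () }

  ≤suc-cases : ∀ {j i} → j within suc i → j within i ⊎ j ≡ suc i
  ≤suc-cases (1≤j , j≤) with ℕ.m≤n⇒m<n∨m≡n j≤
  ... | inj₁ (s≤s j≤i) = inj₁ (1≤j , j≤i)
  ... | inj₂ j≡        = inj₂ j≡

  within-suc : ∀ {j i} → j within i → j within suc i
  within-suc (1≤j , j≤i) = 1≤j , ℕ.m≤n⇒m≤1+n j≤i

  module _ {i p S V E} (st : State i p S V E) where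
    open State st

    private
      t = suc i

      ∈-∷ʳ⁺ : ∀ {x L} → x ∈ L ⊎ x ≡ t → x ∈ L ∷ʳ t
      ∈-∷ʳ⁺ (inj₁ x∈)           = ∈-++⁺ˡ x∈
      ∈-∷ʳ⁺ {L = L} (inj₂ refl) = ∈-++⁺ʳ L (here refl)

    unsourced : p (suc i) ≡ 0
    unsourced with p (suc i) in e
    ... | zero  = refl
    ... | suc _ = contradiction (proj₂ (support (λ z → contradiction (trans (sym e) z) λ ()))) (ℕ.<⇒≱ ℕ.≤-refl)

    unattained : ∀ j → p j ≢ suc i
    unattained j e = contradiction (subst (_≤ i) e (bounded (λ z → contradiction (trans (sym e) z) λ ()))) (ℕ.<⇒≱ ℕ.≤-refl)

    S-< : ∀ {s} → s ∈ S → s < suc i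
    S-< s∈ = s≤s (proj₂ (proj₁ (∈S⁻ s∈)))

    V-< : ∀ {v} → v ∈ V → v < suc i
    V-< v∈ = s≤s (proj₂ (proj₁ (∈V⁻ v∈)))

    -- The new point enters as a path of its own, with neither image nor preimage. Every move of the
    -- scan is this followed by `link`s: none for a valley, one for a rise, a fall or a fixed point,
    -- two for a peak.
    extend : State (suc i) p (S ∷ʳ suc i) (V ∷ʳ suc i) (E [ suc i ↦ suc i ])
    extend = record
      { support = within-suc ∘ support ; bounded = ℕ.m≤n⇒m≤1+n ∘ bounded ; injective = injective
      ; odd-≤ = odd-≤ ; even-≥ = even-≥
      ; ∈S⁻ = λ j∈ → S⁻ (∈-∷ʳ⁻ S j∈)
      ; ∈S⁺ = λ j∈ pj≡0 → ∈-∷ʳ⁺ (S⁺ pj≡0 (≤suc-cases j∈))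
      ; ∈V⁻ = λ v∈ → V⁻ (∈-∷ʳ⁻ V v∈)
      ; ∈V⁺ = λ v∈ free → ∈-∷ʳ⁺ (V⁺ free (≤suc-cases v∈))
      ; S-sorted = sorted-∷ʳ S-sorted S-< ; V-sorted = sorted-∷ʳ V-sorted V-<
      ; balanced = trans (length-∷ʳ S t) (trans (cong suc balanced) (sym (length-∷ʳ V t)))
      ; E∈S = λ v∈ → E′∈ (∈-∷ʳ⁻ V v∈)
      ; E-inj = λ v∈ w∈ → E′-inj (∈-∷ʳ⁻ V v∈) (∈-∷ʳ⁻ V w∈)
      ; E-path = λ v∈ → E′-path (∈-∷ʳ⁻ V v∈) }
      where
      E′ = E [ t ↦ t ]
      E′-old : ∀ {v} → v ∈ V → E′ v ≡ E v
      E′-old v∈ = [↦]-other E (ℕ.<⇒≢ (V-< v∈))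
      E′-new : E′ t ≡ t
      E′-new = [↦]-same E t t
      S⁻ : ∀ {j} → j ∈ S ⊎ j ≡ t → j within t × p j ≡ 0
      S⁻ (inj₁ j∈)   = let w , z = ∈S⁻ j∈ in within-suc w , z
      S⁻ (inj₂ refl) = (s≤s z≤n , ℕ.≤-refl) , unsourced
      S⁺ : ∀ {j} → p j ≡ 0 → j within i ⊎ j ≡ t → j ∈ S ⊎ j ≡ t
      S⁺ z (inj₁ w) = inj₁ (∈S⁺ w z)
      S⁺ z (inj₂ e) = inj₂ e
      V⁻ : ∀ {v} → v ∈ V ⊎ v ≡ t → v within t × (∀ j → p j ≢ v)
      V⁻ (inj₁ v∈)   = let w , z = ∈V⁻ v∈ in within-suc w , z
      V⁻ (inj₂ refl) = (s≤s z≤n , ℕ.≤-refl) , unattained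
      V⁺ : ∀ {v} → (∀ j → p j ≢ v) → v within i ⊎ v ≡ t → v ∈ V ⊎ v ≡ t
      V⁺ z (inj₁ w) = inj₁ (∈V⁺ w z)
      V⁺ z (inj₂ e) = inj₂ e
      E′∈ : ∀ {v} → v ∈ V ⊎ v ≡ t → E′ v ∈ S ∷ʳ t
      E′∈ (inj₁ v∈)   = subst (_∈ S ∷ʳ t) (sym (E′-old v∈)) (∈-∷ʳ⁺ (inj₁ (E∈S v∈)))
      E′∈ (inj₂ refl) = subst (_∈ S ∷ʳ t) (sym E′-new) (∈-∷ʳ⁺ (inj₂ refl))
      E′-inj : ∀ {v w} → v ∈ V ⊎ v ≡ t → w ∈ V ⊎ w ≡ t → E′ v ≡ E′ w → v ≡ w
      E′-inj (inj₁ v∈)   (inj₁ w∈)   e = E-inj v∈ w∈ (trans (sym (E′-old v∈)) (trans e (E′-old w∈)))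
      E′-inj (inj₁ v∈)   (inj₂ refl) e = contradiction (trans (sym (E′-old v∈)) (trans e E′-new)) (ℕ.<⇒≢ (S-< (E∈S v∈)))
      E′-inj (inj₂ refl) (inj₁ w∈)   e = contradiction (trans (sym (E′-old w∈)) (trans (sym e) E′-new)) (ℕ.<⇒≢ (S-< (E∈S w∈)))
      E′-inj (inj₂ refl) (inj₂ refl) e = refl
      E′-path : ∀ {v} → v ∈ V ⊎ v ≡ t → Path p v (E′ v)
      E′-path (inj₁ v∈)   = subst (Path p _) (sym (E′-old v∈)) (E-path v∈)
      E′-path (inj₂ refl) = subst (Path p t) (sym E′-new) ε

    -- The path that ends in a is continued by the path that starts in b, so its end becomes `E b`.
    -- If these are the same path, it closes to a cycle: then `E b` is a, and by injectivity of `E`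
    -- no remaining path ends in a, so the correction of `E` has no effect on them.
    link : ∀ {a b} → a ∈ S → b ∈ V → (isOdd a ≡ true → a ≤ b) → (isOdd a ≡ false → b ≤ a) →
           State i (p [ a ↦ b ]) (S ∖ a) (V ∖ b) ((id [ a ↦ E b ]) ∘ E)
    link {a} {b} a∈ b∈ a-odd a-even = record
      { support   = λ {j} h → [ (λ { refl → a-within }) , (λ j≢a → support (subst (_≢ 0) (old j≢a) h)) ] (j ≟? a)
      ; bounded   = λ {j} h → [ (λ { refl → subst (_≤ i) (sym new) (proj₂ b-within) })
                              , (λ j≢a → subst (_≤ i) (sym (old j≢a)) (bounded (subst (_≢ 0) (old j≢a) h))) ] (j ≟? a)
      ; injective = λ {x} {y} → inj (x ≟? a) (y ≟? a)
      ; odd-≤     = λ {j} h o → [ (λ { refl → subst (a ≤_) (sym new) (a-odd o) })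
                                , (λ j≢a → subst (j ≤_) (sym (old j≢a)) (odd-≤ (subst (_≢ 0) (old j≢a) h) o)) ] (j ≟? a)
      ; even-≥    = λ {j} h o → [ (λ { refl → subst (_≤ a) (sym new) (a-even o) })
                                , (λ j≢a → subst (_≤ j) (sym (old j≢a)) (even-≥ (subst (_≢ 0) (old j≢a) h) o)) ] (j ≟? a)
      ; ∈S⁻       = λ j∈ → let j∈S , j≢a = ∈-∖⁻ S j∈ ; w , z = ∈S⁻ j∈S in w , trans (old j≢a) z
      ; ∈S⁺       = λ {j} w z → [ (λ { refl → contradiction (trans (sym new) z) b≢0 })
                                , (λ j≢a → ∈-∖⁺ (∈S⁺ w (trans (sym (old j≢a)) z)) j≢a) ] (j ≟? a)
      ; ∈V⁻       = λ {v} v∈ → let v∈V , v≢b = ∈-∖⁻ V v∈ ; w , free = ∈V⁻ v∈V in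
                      w , λ j e → [ (λ { refl → v≢b (trans (sym e) new) }) , (λ j≢a → free j (trans (sym (old j≢a)) e)) ] (j ≟? a)
      ; ∈V⁺       = λ {v} w free → ∈-∖⁺
                      (∈V⁺ w (λ j e → [ (λ { refl → contradiction (trans (sym e) a-free) (1≤⇒≢0 (proj₁ w)) })
                                      , (λ j≢a → free j (trans (old j≢a) e)) ] (j ≟? a)))
                      (λ { refl → free a new })
      ; S-sorted  = AllPairs.filter⁺ _ S-sorted
      ; V-sorted  = AllPairs.filter⁺ _ V-sorted
      ; balanced  = ℕ.suc-injective (trans (length-∖ (sorted⇒unique S-sorted) a∈)
                      (trans balanced (sym (length-∖ (sorted⇒unique V-sorted) b∈))))
      ; E∈S       = λ v∈ → let v∈V , v≢b = ∈-∖⁻ V v∈ in E′∈ v∈V v≢b (E _ ≟? a)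
      ; E-inj     = λ v∈ w∈ → let v∈V , v≢b = ∈-∖⁻ V v∈ ; w∈V , w≢b = ∈-∖⁻ V w∈ in
                      E′-inj v∈V v≢b w∈V w≢b (E _ ≟? a) (E _ ≟? a)
      ; E-path    = λ v∈ → E′-path (proj₁ (∈-∖⁻ V v∈)) (E _ ≟? a)
      }
      where

      _≟?_ : ∀ x y → x ≡ y ⊎ x ≢ y
      x ≟? y with x ℕ.≟ y
      ... | yes e = inj₁ e
      ... | no ne = inj₂ ne
      1≤⇒≢0 : ∀ {x} → 1 ≤ x → x ≢ 0
      1≤⇒≢0 (s≤s _) ()
      p′ = p [ a ↦ b ]
      E′ = (id [ a ↦ E b ]) ∘ E
      new : p′ a ≡ b
      new = [↦]-same p a b
      old : ∀ {x} → x ≢ a → p′ x ≡ p x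
      old = [↦]-other p
      a-within = proj₁ (∈S⁻ a∈)
      a-free = proj₂ (∈S⁻ a∈)
      b-within = proj₁ (∈V⁻ b∈)
      b-free = proj₂ (∈V⁻ b∈)
      b≢0 = 1≤⇒≢0 (proj₁ b-within)
      inj : ∀ {x y} → x ≡ a ⊎ x ≢ a → y ≡ a ⊎ y ≢ a → p′ x ≢ 0 → p′ x ≡ p′ y → x ≡ y
      inj (inj₁ refl) (inj₁ refl) h e = refl
      inj (inj₁ refl) (inj₂ y≢a)  h e = contradiction (trans (sym (old y≢a)) (trans (sym e) new)) (b-free _)
      inj (inj₂ x≢a)  (inj₁ refl) h e = contradiction (trans (sym (old x≢a)) (trans e new)) (b-free _)
      inj (inj₂ x≢a)  (inj₂ y≢a)  h e = injective (subst (_≢ 0) (old x≢a) h) (trans (sym (old x≢a)) (trans e (old y≢a)))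
      joined : ∀ {v} → E v ≡ a → E′ v ≡ E b
      joined {v} e = trans (cong (id [ a ↦ E b ]) e) ([↦]-same id a (E b))
      kept : ∀ {v} → E v ≢ a → E′ v ≡ E v
      kept = [↦]-other id
      E′∈ : ∀ {v} → v ∈ V → v ≢ b → E v ≡ a ⊎ E v ≢ a → E′ v ∈ S ∖ a
      E′∈ v∈ v≢b (inj₁ e)  = subst (_∈ S ∖ a) (sym (joined e)) (∈-∖⁺ (E∈S b∈) (λ e′ → v≢b (E-inj v∈ b∈ (trans e (sym e′)))))
      E′∈ v∈ v≢b (inj₂ ne) = subst (_∈ S ∖ a) (sym (kept ne)) (∈-∖⁺ (E∈S v∈) ne)
      E′-inj : ∀ {v w} → v ∈ V → v ≢ b → w ∈ V → w ≢ b → E v ≡ a ⊎ E v ≢ a → E w ≡ a ⊎ E w ≢ a → E′ v ≡ E′ w → v ≡ w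
      E′-inj v∈ v≢b w∈ w≢b (inj₁ e)  (inj₁ e′)  h = E-inj v∈ w∈ (trans e (sym e′))
      E′-inj v∈ v≢b w∈ w≢b (inj₁ e)  (inj₂ ne′) h = contradiction (E-inj w∈ b∈ (trans (sym (kept ne′)) (trans (sym h) (joined e)))) w≢b
      E′-inj v∈ v≢b w∈ w≢b (inj₂ ne) (inj₁ e′)  h = contradiction (E-inj v∈ b∈ (trans (sym (kept ne)) (trans h (joined e′)))) v≢b
      E′-inj v∈ v≢b w∈ w≢b (inj₂ ne) (inj₂ ne′) h = E-inj v∈ w∈ (trans (sym (kept ne)) (trans h (kept ne′)))
      -- An old path may end in a but never leaves it, as a had no image; so the new arc does not
      -- disturb it.
      lift : ∀ {x y} → Path p x y → Path p′ x y
      lift ε = ε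
      lift {x} {y} (h ◅ π) = subst (_≢ 0) (sym (old x≢a)) h ◅ subst (λ z → Path p′ z y) (sym (old x≢a)) (lift π)
        where x≢a : x ≢ a
              x≢a refl = h a-free
      E′-path : ∀ {v} → v ∈ V → E v ≡ a ⊎ E v ≢ a → Path p′ v (E′ v)
      E′-path {v} v∈ (inj₁ e) = subst (Path p′ v) (sym (joined e))
        (subst (Path p′ v) e (lift (E-path v∈)) ◅◅ (subst (_≢ 0) (sym new) b≢0 ◅ subst (λ z → Path p′ z (E b)) (sym new) (lift (E-path b∈))))
      E′-path {v} v∈ (inj₂ ne) = subst (Path p′ v) (sym (kept ne)) (lift (E-path v∈))

  -- Permutations that agree with a partial one

  -- An undefined image is not a free one: it must exceed i. Hence f determines p on [1, i], and
  -- different moves of the scan exclude each other.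
  Agree : (ℕ → ℕ) → ℕ → (ℕ → ℕ) → Set
  Agree f i p = ∀ j → j within i → (p j ≡ 0 → i < f j) × (p j ≢ 0 → f j ≡ p j)

  agreeᵇ : (ℕ → ℕ) → ℕ → (ℕ → ℕ) → Bool
  agreeᵇ f i p = all (λ j → if p j ≡ᵇ 0 then i <ᵇ f j else (f j ≡ᵇ p j)) (range i)

  agreeᵇ-reflects : ∀ f i p → Reflects (Agree f i p) (agreeᵇ f i p)
  agreeᵇ-reflects f i p = all-range-reflects i at
    where
    at : ∀ j → Reflects ((p j ≡ 0 → i < f j) × (p j ≢ 0 → f j ≡ p j)) (if p j ≡ᵇ 0 then i <ᵇ f j else (f j ≡ᵇ p j))
    at j with p j
    ... | zero  = reflects-map (λ h → (λ _ → h) , λ z → contradiction refl z) (λ h → proj₁ h refl) (ℕ.<ᵇ-reflects-< i (f j))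
    ... | suc v = reflects-map (λ h → (λ ()) , λ _ → h) (λ h → proj₂ h λ ()) (≡ᵇ-reflects-≡ (f j) (suc v))

  isHead : List ℕ → ℕ → Bool
  isHead []      x = false
  isHead (y ∷ _) x = x ≡ᵇ y

  isHead-reflects : ∀ {L x} → Sorted L → x ∈ L → Reflects (∀ {y} → y ∈ L → x ≤ y) (isHead L x)
  isHead-reflects {y ∷ L} {x} (y< ∷ _) x∈ = reflects-map
    (λ { refl (here refl) → ℕ.≤-refl ; refl (there z∈) → ℕ.<⇒≤ (All.lookup y< z∈) })
    (λ least → head x∈ (least (here refl)))
    (≡ᵇ-reflects-≡ x y)
    where
    head : x ∈ y ∷ L → x ≤ y → x ≡ y
    head (here e)   _   = e
    head (there x∈) x≤y = contradiction x≤y (ℕ.<⇒≱ (All.lookup y< x∈))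

  module _ {f : ℕ → ℕ} {i p S V E} (st : State i p S V E) where
    open State st
    private
      t = suc i

      t-within : t within t
      t-within = s≤s z≤n , ℕ.≤-refl

      within⇒≢t : ∀ {j} → j within i → j ≢ t
      within⇒≢t (_ , j≤i) refl = ℕ.<⇒≱ ℕ.≤-refl j≤i

      S⇒≢t : ∀ {s} → s ∈ S → s ≢ t
      S⇒≢t s∈ = ℕ.<⇒≢ (S-< st s∈)

      arc⇒≢ : ∀ {s j} → s ∈ S → p j ≢ 0 → j ≢ s
      arc⇒≢ s∈ h refl = h (proj₂ (∈S⁻ s∈))

    -- Here q stands for any map that a move can produce from p: the old arcs stay, and a pending
    -- position remains pending or is sent to t. In both cases its image exceeds i, which is all
    -- that `Agree f i p` asks of it.
    Agree-restrict : ∀ {q} → (∀ {j} → j within i → p j ≢ 0 → q j ≡ p j) → (∀ {j} → j ∈ S → q j ≡ 0 ⊎ q j ≡ t) →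
                     Agree f t q → Agree f i p
    Agree-restrict {q} arcs pend ag j w = pending , arc
      where
      pending : p j ≡ 0 → i < f j
      pending z with pend (∈S⁺ w z)
      ... | inj₁ q≡0 = ℕ.<-trans ℕ.≤-refl (proj₁ (ag j (within-suc w)) q≡0)
      ... | inj₂ q≡t = subst (i <_) (sym (trans (proj₂ (ag j (within-suc w)) (subst (_≢ 0) (sym q≡t) λ ())) q≡t)) ℕ.≤-refl
      arc : p j ≢ 0 → f j ≡ p j
      arc h = trans (proj₂ (ag j (within-suc w)) (subst (_≢ 0) (sym (arcs w h)) h)) (arcs w h)

    Agree-extend : ∀ {q} → (∀ {j} → j within i → p j ≢ 0 → q j ≡ p j) →
                   (∀ {j} → j ∈ S → (q j ≡ 0 × f j ≢ t) ⊎ (q j ≡ t × f j ≡ t)) →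
                   (q t ≡ 0 × t < f t) ⊎ (q t ≢ 0 × f t ≡ q t) →
                   Agree f i p → Agree f t q
    Agree-extend {q} arcs pend now ag j w with ≤suc-cases w
    ... | inj₂ refl with now
    ...   | inj₁ (q≡0 , later) = (λ _ → later) , contradiction q≡0
    ...   | inj₂ (q≢0 , e)     = (λ z → contradiction z q≢0) , λ _ → e
    Agree-extend {q} arcs pend now ag j w | inj₁ w′ with p j ℕ.≟ 0
    ... | no h = (λ q≡0 → contradiction (trans (sym (arcs w′ h)) q≡0) h) , λ _ → trans (proj₂ (ag j w′) h) (sym (arcs w′ h))
    ... | yes z with pend (∈S⁺ w′ z)
    ...   | inj₁ (q≡0 , f≢t) = (λ _ → ℕ.≤∧≢⇒< (proj₁ (ag j w′) z) (f≢t ∘ sym)) , contradiction q≡0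
    ...   | inj₂ (q≡t , f≡t) = (λ q≡0 → contradiction (trans (sym q≡t) q≡0) λ ()) , λ _ → trans f≡t (sym q≡t)

    -- Like the lemmas for the other moves, it also extracts what f does at t and at the pending
    -- positions. These facts eliminate all summands but one in `oddStep` and `evenStep`; the
    -- versions marked ⁺ confirm the surviving one.
    Agree-open : Agree f t p → Agree f i p × t < f t × (∀ {s} → s ∈ S → f s ≢ t)
    Agree-open ag = Agree-restrict (λ _ _ → refl) (inj₁ ∘ proj₂ ∘ ∈S⁻) ag , proj₁ (ag t t-within) (unsourced st) ,
      λ s∈ e → let w , z = ∈S⁻ s∈ in ℕ.<-irrefl (sym e) (proj₁ (ag _ (within-suc w)) z)

    Agree-open⁺ : t < f t → (∀ {s} → s ∈ S → f s ≢ t) → Agree f i p → Agree f t p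
    Agree-open⁺ later free = Agree-extend (λ _ _ → refl) (λ s∈ → inj₁ (proj₂ (∈S⁻ s∈) , free s∈)) (inj₁ (unsourced st , later))

    Agree-source : ∀ {s} → s ∈ S → Agree f t (p [ s ↦ t ]) → Agree f i p × t < f t × f s ≡ t
    Agree-source {s} s∈ ag =
      Agree-restrict (λ _ h → [↦]-other p (arc⇒≢ s∈ h)) pend ag ,
      proj₁ (ag t t-within) (trans ([↦]-other p (S⇒≢t s∈ ∘ sym)) (unsourced st)) ,
      trans (proj₂ (ag s (within-suc (proj₁ (∈S⁻ s∈)))) (subst (_≢ 0) (sym ([↦]-same p s t)) λ ())) ([↦]-same p s t)
      where
      pend : ∀ {j} → j ∈ S → (p [ s ↦ t ]) j ≡ 0 ⊎ (p [ s ↦ t ]) j ≡ t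
      pend {j} j∈ with j ℕ.≟ s
      ... | yes refl = inj₂ ([↦]-same p s t)
      ... | no j≢s   = inj₁ (trans ([↦]-other p j≢s) (proj₂ (∈S⁻ j∈)))

    Agree-image : ∀ {v} → v ≢ 0 → Agree f t (p [ t ↦ v ]) → Agree f i p × f t ≡ v × (∀ {s} → s ∈ S → f s ≢ t)
    Agree-image {v} v≢0 ag =
      Agree-restrict (λ w _ → [↦]-other p (within⇒≢t w)) (λ s∈ → inj₁ (zero′ s∈)) ag ,
      trans (proj₂ (ag t t-within) (subst (_≢ 0) (sym ([↦]-same p t v)) v≢0)) ([↦]-same p t v) ,
      λ s∈ e → ℕ.<-irrefl (sym e) (proj₁ (ag _ (within-suc (proj₁ (∈S⁻ s∈)))) (zero′ s∈))
      where
      zero′ : ∀ {s} → s ∈ S → (p [ t ↦ v ]) s ≡ 0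
      zero′ s∈ = trans ([↦]-other p (S⇒≢t s∈)) (proj₂ (∈S⁻ s∈))

    Agree-image⁺ : ∀ {v} → v ≢ 0 → f t ≡ v → (∀ {s} → s ∈ S → f s ≢ t) → Agree f i p → Agree f t (p [ t ↦ v ])
    Agree-image⁺ {v} v≢0 e free = Agree-extend (λ w _ → [↦]-other p (within⇒≢t w))
      (λ s∈ → inj₁ (trans ([↦]-other p (S⇒≢t s∈)) (proj₂ (∈S⁻ s∈)) , free s∈))
      (inj₂ (subst (_≢ 0) (sym ([↦]-same p t v)) v≢0 , trans e (sym ([↦]-same p t v))))

    Agree-source⁺ : ∀ {s} → s ∈ S → t < f t → f s ≡ t → (∀ {j} → j ∈ S → f j ≡ t → j ≡ s) → Agree f i p → Agree f t (p [ s ↦ t ])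
    Agree-source⁺ {s} s∈ later e only = Agree-extend (λ _ h → [↦]-other p (arc⇒≢ s∈ h)) pend
      (inj₁ (trans ([↦]-other p (S⇒≢t s∈ ∘ sym)) (unsourced st) , later))
      where
      pend : ∀ {j} → j ∈ S → ((p [ s ↦ t ]) j ≡ 0 × f j ≢ t) ⊎ ((p [ s ↦ t ]) j ≡ t × f j ≡ t)
      pend {j} j∈ with j ℕ.≟ s
      ... | yes refl = inj₂ ([↦]-same p s t , e)
      ... | no j≢s   = inj₁ (trans ([↦]-other p j≢s) (proj₂ (∈S⁻ j∈)) , j≢s ∘ only j∈)

    Agree-both : ∀ {v s} → v ≢ 0 → s ∈ S → Agree f t (p [ t ↦ v ] [ s ↦ t ]) → Agree f i p × f t ≡ v × f s ≡ t
    Agree-both {v} {s} v≢0 s∈ ag =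
      Agree-restrict (λ w h → trans ([↦]-other q (arc⇒≢ s∈ h)) ([↦]-other p (within⇒≢t w))) pend ag ,
      trans (proj₂ (ag t t-within) (subst (_≢ 0) (sym now) v≢0)) now ,
      trans (proj₂ (ag s (within-suc (proj₁ (∈S⁻ s∈)))) (subst (_≢ 0) (sym ([↦]-same q s t)) λ ())) ([↦]-same q s t)
      where
      q = p [ t ↦ v ]
      now : (q [ s ↦ t ]) t ≡ v
      now = trans ([↦]-other q (S⇒≢t s∈ ∘ sym)) ([↦]-same p t v)
      pend : ∀ {j} → j ∈ S → (q [ s ↦ t ]) j ≡ 0 ⊎ (q [ s ↦ t ]) j ≡ t
      pend {j} j∈ with j ℕ.≟ s
      ... | yes refl = inj₂ ([↦]-same q s t)
      ... | no j≢s   = inj₁ (trans ([↦]-other q j≢s) (trans ([↦]-other p (S⇒≢t j∈)) (proj₂ (∈S⁻ j∈))))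

    Agree-both⁺ : ∀ {v s} → v ≢ 0 → s ∈ S → f t ≡ v → f s ≡ t → (∀ {j} → j ∈ S → f j ≡ t → j ≡ s) →
                  Agree f i p → Agree f t (p [ t ↦ v ] [ s ↦ t ])
    Agree-both⁺ {v} {s} v≢0 s∈ ft≡v fs≡t only =
      Agree-extend (λ w h → trans ([↦]-other q (arc⇒≢ s∈ h)) ([↦]-other p (within⇒≢t w))) pend
        (inj₂ (subst (_≢ 0) (sym now) v≢0 , trans ft≡v (sym now)))
      where
      q = p [ t ↦ v ]
      now : (q [ s ↦ t ]) t ≡ v
      now = trans ([↦]-other q (S⇒≢t s∈ ∘ sym)) ([↦]-same p t v)
      pend : ∀ {j} → j ∈ S → ((q [ s ↦ t ]) j ≡ 0 × f j ≢ t) ⊎ ((q [ s ↦ t ]) j ≡ t × f j ≡ t)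
      pend {j} j∈ with j ℕ.≟ s
      ... | yes refl = inj₂ ([↦]-same q s t , fs≡t)
      ... | no j≢s   = inj₁ (trans ([↦]-other q j≢s) (trans ([↦]-other p (S⇒≢t j∈)) (proj₂ (∈S⁻ j∈))) , j≢s ∘ only j∈)

  -- Records, antirecords and cycle maxima as seen by the scan

  module Records (s : List ℕ) where

    isRecord-reflects : ∀ x → Reflects (∀ j → j within (x ∸ 1) → ap s j < ap s x) (isRecord s x)
    isRecord-reflects x = all-range-reflects (x ∸ 1) (λ j → ℕ.<ᵇ-reflects-< (ap s j) (ap s x))

    isAntirecord-reflects : ∀ x → Reflects (∀ j → j within length s → x < j → ap s x < ap s j) (isAntirecord s x)
    isAntirecord-reflects x = reflects-map
      (λ h j w x<j → h j (∈-filter⁺ P? (∈-range⁺ w) (ℕ.<⇒<ᵇ x<j)))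
      (λ h j j∈ → let j∈′ , x<j = ∈-filter⁻ P? {xs = range (length s)} j∈ in h j (∈-range⁻ j∈′) (ℕ.<ᵇ⇒< x j x<j))
      (all-reflects _ (λ j → ℕ.<ᵇ-reflects-< (ap s x) (ap s j)))
      where P? = λ j → T? (x <ᵇ j)

    earlier-≥⇒¬record : ∀ {x j} → 1 ≤ j → j < x → ap s x ≤ ap s j → isRecord s x ≡ false
    earlier-≥⇒¬record {suc x} 1≤j (s≤s j≤x) le = reflects-false (isRecord-reflects (suc x)) λ h → ℕ.<⇒≱ (h _ (1≤j , j≤x)) le

    later-≤⇒¬antirecord : ∀ {x j} → j within length s → x < j → ap s j ≤ ap s x → isAntirecord s x ≡ false
    later-≤⇒¬antirecord w x<j le = reflects-false (isAntirecord-reflects _) λ h → ℕ.<⇒≱ (h _ w x<j) le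

  module Scan {s} (perm : IsDPermutation (length s) (ap s)) {i p S V E} (st : State i p S V E)
              (t≤N : suc i ≤ length s) (agree : Agree (ap s) i p) where
    open IsDPermutation perm using (maps) renaming (injective to ap-injective)
    open Cycles s maps ap-injective
    open Records s
    open State st
    private
      f = ap s
      t = suc i

    t-within : t within N
    t-within = s≤s z≤n , t≤N

    within-N : ∀ {j} → j within i → j within N
    within-N (1≤j , j≤i) = 1≤j , ℕ.≤-trans j≤i (ℕ.<⇒≤ t≤N)

    after : ∀ {j} → i < j → j ≤ N → j within N
    after (s≤s _) j≤N = s≤s z≤n , j≤N

    S-later : ∀ {j} → j ∈ S → i < f j
    S-later j∈ = let w , z = ∈S⁻ j∈ in proj₁ (agree _ w) z

    later-S : ∀ {j} → j within i → i < f j → j ∈ S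
    later-S {j} w later with p j ℕ.≟ 0
    ... | yes z = ∈S⁺ w z
    ... | no h  = contradiction (subst (_≤ i) (sym (proj₂ (agree j w) h)) (bounded h)) (ℕ.<⇒≱ later)

    -- A preimage j ≤ i of v would either be pending, with image above i, or give an arc of p to v;
    -- the first contradicts v ≤ i, the second v ∈ V.
    V-preimage : ∀ {v} → v ∈ V → ∃ λ j → i < j × j ≤ N × f j ≡ v
    V-preimage v∈ with ∈V⁻ v∈
    ... | (1≤v , v≤i) , free with surjective (within-N (1≤v , v≤i))
    ...   | j , (1≤j , j≤N) , e with j ℕ.≤? i
    ...     | no j≰i = j , ℕ.≰⇒> j≰i , j≤N , e
    ...     | yes j≤i with p j ℕ.≟ 0
    ...       | yes z = contradiction (subst (_≤ i) (sym e) v≤i) (ℕ.<⇒≱ (proj₁ (agree j (1≤j , j≤i)) z))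
    ...       | no h  = contradiction (trans (sym (proj₂ (agree j (1≤j , j≤i)) h)) e) (free j)

    preimage-V : ∀ {j} → i < j → j ≤ N → f j ≤ i → f j ∈ V
    preimage-V {j} i<j j≤N fj≤i = ∈V⁺ (proj₁ (maps (after i<j j≤N)) , fj≤i) free
      where
      free : ∀ k → p k ≢ f j
      free k e = ℕ.<⇒≱ i<j (subst (_≤ i) (ap-injective (within-N w) (after i<j j≤N) (trans (proj₂ (agree k w) h) e)) (proj₂ w))
        where
        h : p k ≢ 0
        h z = contradiction (subst (1 ≤_) (trans (sym e) z) (proj₁ (maps (after i<j j≤N)))) λ ()
        w = support h

    inv-source : ∀ {j} → j ∈ S → f j ≡ t → inv s t ≡ j
    inv-source j∈ e = trans (cong (inv s) (sym e)) (inv-ap (within-N (proj₁ (∈S⁻ j∈))))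

    source-unique : ∀ {x y} → y ∈ S → f y ≡ t → x ∈ S → f x ≡ t → x ≡ y
    source-unique y∈ ey x∈ ex = ap-injective (within-N (proj₁ (∈S⁻ x∈))) (within-N (proj₁ (∈S⁻ y∈))) (trans ex (sym ey))

    later-preimage : (∀ {j} → j ∈ S → f j ≢ t) → f t ≢ t → ∃ λ j → t < j × j within N × f j ≡ t
    later-preimage free ft≢t with surjective t-within
    ... | j , w , e with j ℕ.≤? i
    ...   | yes j≤i = contradiction e (free (later-S (proj₁ w , j≤i) (ℕ.≤-reflexive (sym e))))
    ...   | no j≰i  = j , ℕ.≤∧≢⇒< (ℕ.≰⇒> j≰i) (λ { refl → ft≢t e }) , w , e

    inv-later : (∀ {j} → j ∈ S → f j ≢ t) → f t ≢ t → t < inv s t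
    inv-later free ft≢t = let j , t<j , w , e = later-preimage free ft≢t in
      subst (t <_) (trans (sym (inv-ap w)) (cong (inv s) e)) t<j

    -- S consists of the positions up to i whose image exceeds i, that is, is at least t = f j. So
    -- the positions that could spoil the record at j are the elements of S below j.
    record-source : ∀ {j} → j ∈ S → f j ≡ t → isRecord s j ≡ isHead S j
    record-source {j} j∈ e = det (isRecord-reflects j) (reflects-map to from (isHead-reflects S-sorted j∈))
      where
      j-within = proj₁ (∈S⁻ j∈)
      to : (∀ {y} → y ∈ S → j ≤ y) → ∀ k → k within (j ∸ 1) → f k < f j
      to least k (1≤k , k≤) = subst (f k <_) (sym e) (ℕ.≰⇒> λ t≤fk →
        ℕ.<⇒≱ k<j (least (later-S (1≤k , ℕ.≤-trans (ℕ.<⇒≤ k<j) (proj₂ j-within)) t≤fk)))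
        where k<j : k < j
              k<j = ℕ.≤-trans (s≤s k≤) (ℕ.≤-reflexive (ℕ.suc-pred j {{ℕ.>-nonZero (proj₁ j-within)}}))
      from : (∀ k → k within (j ∸ 1) → f k < f j) → ∀ {y} → y ∈ S → j ≤ y
      from h {y} y∈ = ℕ.≮⇒≥ λ y<j → ℕ.<⇒≱ (subst (f y <_) e (h y (proj₁ (proj₁ (∈S⁻ y∈)) , ℕ.pred-mono-≤ y<j))) (S-later y∈)

    -- The values up to i that are taken after position i are those in V. So a smaller value after t
    -- means an element of V below f t.
    antirecord-image : f t ∈ V → isAntirecord s t ≡ isHead V (f t)
    antirecord-image v∈ = det (isAntirecord-reflects t) (reflects-map to from (isHead-reflects V-sorted v∈))
      where
      to : (∀ {y} → y ∈ V → f t ≤ y) → ∀ j → j within N → t < j → f t < f j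
      to least j w t<j = ℕ.≰⇒> λ fj≤ft →
        let fj<ft = ℕ.≤∧≢⇒< fj≤ft (λ e → ℕ.<⇒≢ t<j (sym (ap-injective w t-within e))) in
        ℕ.<⇒≱ fj<ft (least (preimage-V (ℕ.<⇒≤ t<j) (proj₂ w) (ℕ.≤-trans fj≤ft (proj₂ (proj₁ (∈V⁻ v∈))))))
      from : (∀ j → j within N → t < j → f t < f j) → ∀ {y} → y ∈ V → f t ≤ y
      from h {y} y∈ = let j , i<j , j≤N , e = V-preimage y∈ in ℕ.≮⇒≥ λ y<ft →
        ℕ.<⇒≱ (h j (after i<j j≤N) (ℕ.≤∧≢⇒< i<j (λ t≡j → ℕ.<⇒≢ y<ft (sym (trans (cong f t≡j) e))))) (subst (_≤ f t) (sym e) (ℕ.<⇒≤ y<ft))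

    -- An open path ends in an earlier position whose image is at least t.
    ¬record-below : ∀ {j} → j ∈ S → f t ≤ t → isRecord s t ≡ false
    ¬record-below j∈ ft≤t = earlier-≥⇒¬record (proj₁ (proj₁ (∈S⁻ j∈))) (S-< st j∈) (ℕ.≤-trans ft≤t (S-later j∈))

    -- The value v < t is still to come, and position t does not take it.
    ¬antirecord-above : ∀ {v} → v ∈ V → t ≤ f t → isAntirecord s t ≡ false
    ¬antirecord-above {v} v∈ t≤ft = let j , i<j , j≤N , e = V-preimage v∈ in
      later-≤⇒¬antirecord (after i<j j≤N)
        (ℕ.≤∧≢⇒< i<j (λ t≡j → ℕ.<⇒≱ (V-< st v∈) (subst (t ≤_) (trans (cong f t≡j) e) t≤ft)))
        (subst (_≤ f t) (sym e) (ℕ.<⇒≤ (ℕ.<-≤-trans (V-< st v∈) t≤ft)))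

    ¬antirecord-valley : (∀ {j} → j ∈ S → f j ≢ t) → t < f t → isAntirecord s t ≡ false
    ¬antirecord-valley free t<ft = let j , t<j , w , e = later-preimage free (ℕ.<⇒≢ t<ft ∘ sym) in
      later-≤⇒¬antirecord w t<j (subst (_≤ f t) (sym e) (ℕ.<⇒≤ t<ft))

    -- Without open paths σ maps [1, i] to itself, so the values before t are all smaller; the next
    -- lemma is the mirror image.
    record-closed : (∀ {j} → ¬ j ∈ S) → f t ≡ t → isRecord s t ≡ true
    record-closed none e = reflects-true (isRecord-reflects t) λ j w →
      subst (f j <_) (sym e) (ℕ.≰⇒> λ t≤fj → none (later-S w t≤fj))

    antirecord-closed : (∀ {v} → ¬ v ∈ V) → f t ≡ t → isAntirecord s t ≡ true
    antirecord-closed none e = reflects-true (isAntirecord-reflects t) λ j w t<j →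
      subst (_< f j) (sym e) (ℕ.≤∧≢⇒< (ℕ.≰⇒> (λ fj≤i → none (preimage-V (ℕ.<⇒≤ t<j) (proj₂ w) fj≤i)))
        (λ t≡fj → ℕ.<⇒≢ t<j (ap-injective t-within w (trans e t≡fj))))

    ¬cycMax-excedance : t < f t → cycMax s t ≡ false
    ¬cycMax-excedance t<ft = reflects-false (cycMax-reflects t-within) λ h → ℕ.<⇒≱ t<ft (h 1)

    cycMax-fixed : f t ≡ t → cycMax s t ≡ true
    cycMax-fixed e = reflects-true (cycMax-reflects t-within) λ k → ℕ.≤-reflexive (fixed k)
      where
      fixed : ∀ k → iter s k t ≡ t
      fixed zero    = refl
      fixed (suc k) = trans (cong f (fixed k)) e

    path-iter : ∀ {x y} → Path p x y → ∃ λ k → iter s k x ≡ y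
    path-iter ε = 0 , refl
    path-iter {x} (h ◅ π) = let k , e = path-iter π in
      k ℕ.+ 1 , trans (iter-+ k 1 x) (trans (cong (iter s k) (proj₂ (agree x (support h)) h)) e)

    -- The cycle of t runs through f t to the end of its path, and from there to an image that
    -- exceeds i and differs from t, hence exceeds t.
    ¬cycMax-open : f t ∈ V → f (E (f t)) ≢ t → cycMax s t ≡ false
    ¬cycMax-open v∈ f≢t = reflects-false (cycMax-reflects t-within) λ h →
      let k , e = path-iter (E-path v∈) in
      ℕ.<⇒≱ (ℕ.≤∧≢⇒< (S-later (E∈S v∈)) (f≢t ∘ sym))
            (subst (_≤ t) (cong f (trans (iter-+ k 1 t) e)) (h (suc (k ℕ.+ 1))))

    -- The orbit of t never leaves t and the path from f t to its end, all of whose points are at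
    -- most i.
    cycMax-closed : f t ∈ V → f (E (f t)) ≡ t → cycMax s t ≡ true
    cycMax-closed v∈ closes = reflects-true (cycMax-reflects t-within) λ k → below (orbit k)
      where
      e = E (f t)
      orbit : ∀ k → iter s k t ≡ t ⊎ Path p (iter s k t) e
      next : ∀ {x} → x ≡ t ⊎ Path p x e → f x ≡ t ⊎ Path p (f x) e
      next (inj₁ refl)    = inj₂ (E-path v∈)
      next (inj₂ ε)       = inj₁ closes
      next {x} (inj₂ (h ◅ π)) = inj₂ (subst (λ y → Path p y e) (sym (proj₂ (agree x (support h)) h)) π)
      orbit zero    = inj₁ refl
      orbit (suc k) = next (orbit k)
      below : ∀ {x} → x ≡ t ⊎ Path p x e → x ≤ t
      below (inj₁ refl)    = ℕ.≤-refl
      below (inj₂ ε)       = ℕ.<⇒≤ (S-< st (E∈S v∈))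
      below (inj₂ (h ◅ _)) = ℕ.m≤n⇒m≤1+n (proj₂ (support h))

open DPermutations

-- Weight of a single position

module StepWeight {a} {A : Set a} (_·_ : A → A → A) (ε : A) (x₁ x₂ y₁ ŷ₂ u₁ u₂ v̂₂ wₑ wₒ zₑ zₒ λ′ : A) where

  infixl 7 _∙_
  _∙_ = _·_

  gate : Bool → A → A
  gate b x = if b then x else ε

  -- Contribution of position i to the weight of σ, as a function of the truth values of:
  -- i is a record, i is an antirecord, σ⁻¹(i) < i, σ⁻¹(i) > i, σ(i) < i, σ(i) > i, σ(i) = i,
  -- σ⁻¹(i) is a record, i is odd, i is even, i is the maximum of its cycle.
  stepWeight : (r a l g l′ g′ f r′ o e m : Bool) → A
  stepWeight r a l g l′ g′ f r′ o e m =
       gate ((a ∧ not r) ∧ (l ∧ l′)) x₁     ∙ gate ((a ∧ not r) ∧ (g ∧ l′)) x₂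
    ∙ gate ((r ∧ not a) ∧ (g ∧ g′)) y₁     ∙ gate ((l ∧ g′) ∧ r′) ŷ₂
    ∙ gate ((not r ∧ not a) ∧ (l ∧ l′)) u₁ ∙ gate ((not r ∧ not a) ∧ (g ∧ l′)) u₂
    ∙ gate ((not r ∧ not a) ∧ (g ∧ g′)) y₁ ∙ gate ((l ∧ g′) ∧ not r′) v̂₂
    ∙ gate (e ∧ f ∧ (not r ∧ not a)) wₑ    ∙ gate (o ∧ f ∧ (not r ∧ not a)) wₒ
    ∙ gate (e ∧ (r ∧ a)) zₑ                ∙ gate (o ∧ (r ∧ a)) zₒ
    ∙ gate m λ′

module Weights {c ℓ} (R : CommutativeRing c ℓ)
               (x₁ x₂ y₁ ŷ₂ u₁ u₂ v̂₂ wₑ wₒ zₑ zₒ λ′ : CommutativeRing.Carrier R) where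
  open CommutativeRing R
  open WithRing R
  open FiniteSums commutativeSemiring public
  open StepWeight _*_ 1# x₁ x₂ y₁ ŷ₂ u₁ u₂ v̂₂ wₑ wₒ zₑ zₒ λ′ public
  open import Algebra.Solver.Ring.NaturalCoefficients.Default commutativeSemiring
    using (Polynomial; var; con; _:*_; prove)

  weight : List ℕ → ℕ → Carrier
  weight s i = stepWeight (isRecord s i) (isAntirecord s i) (inv s i <ᵇ i) (i <ᵇ inv s i) (ap s i <ᵇ i) (i <ᵇ ap s i)
                          (ap s i ≡ᵇ i) (isRecord s (inv s i)) (isOdd i) (isEven i) (cycMax s i)

  pow-count : ∀ x p L → pow x (count p L) ≈ ∏ L (λ i → gate (p i) x)
  pow-count x p []      = refl
  pow-count x p (i ∷ L) with p i
  ... | true  = *-congˡ (pow-count x p L)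
  ... | false = trans (pow-count x p L) (sym (*-identityˡ _))

  -- All the statistics count positions, so every power is a product of gates over the positions and
  -- the monomial factors. For `cyc` this happens after passing to cycle maxima, in accordance with
  -- the last gate of `stepWeight`.
  totalWeight : ∀ s → IsDPermutation (length s) (ap s) →
      pow x₁ (eareccpeak s) * pow x₂ (eareccdfall s)
    * pow y₁ (ereccval s)   * pow ŷ₂ (ereccdrise′ s)
    * pow u₁ (nrcpeak s)    * pow u₂ (nrcdfall s)
    * pow y₁ (nrcval s)     * pow v̂₂ (nrcdrise′ s)
    * pow wₑ (evennrfix s)  * pow wₒ (oddnrfix s)
    * pow zₑ (evenrar s)    * pow zₒ (oddrar s)
    * pow λ′ (cyc s) ≈ ∏ (range (length s)) (weight s)
  totalWeight s perm =
      pow-count x₁ _ L ⊗ pow-count x₂ _ L ⊗ pow-count y₁ _ L ⊗ pow-count ŷ₂ _ L ⊗ pow-count u₁ _ L ⊗ pow-count u₂ _ L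
    ⊗ pow-count y₁ _ L ⊗ pow-count v̂₂ _ L ⊗ pow-count wₑ _ L ⊗ pow-count wₒ _ L ⊗ pow-count zₑ _ L ⊗ pow-count zₒ _ L
    ⊗ trans (reflexive (≡.cong (pow λ′) (Cycles.cyc≡cnt-cycMax s maps injective))) (pow-count λ′ (cycMax s) L)
    where
    open IsDPermutation perm
    L = range (length s)
    infixl 5 _⊗_
    _⊗_ : ∀ {A B f g} → A ≈ ∏ L f → B ≈ ∏ L g → A * B ≈ ∏ L (λ i → f i * g i)
    p ⊗ q = trans (*-cong p q) (sym (∏-* L _ _))

  private
    ρ : Vec Carrier 12
    ρ = x₁ ∷ x₂ ∷ y₁ ∷ ŷ₂ ∷ u₁ ∷ u₂ ∷ v̂₂ ∷ wₑ ∷ wₒ ∷ zₑ ∷ zₒ ∷ λ′ ∷ []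
    X₁ X₂ Y₁ Ŷ₂ U₁ U₂ V̂₂ Wₑ Wₒ Zₑ Zₒ Λ : Polynomial 12
    X₁ = var 0F ; X₂ = var 1F ; Y₁ = var 2F ; Ŷ₂ = var 3F ; U₁ = var 4F ; U₂ = var 5F
    V̂₂ = var 6F ; Wₑ = var 7F ; Wₒ = var 8F ; Zₑ = var 9F ; Zₒ = var (Fin.suc 9F) ; Λ = var (Fin.suc (Fin.suc 9F))
    -- The same product as a syntactic polynomial, for the ring solver to drop its factors 1#.
    open StepWeight _:*_ (con 1) X₁ X₂ Y₁ Ŷ₂ U₁ U₂ V̂₂ Wₑ Wₒ Zₑ Zₒ Λ using () renaming (stepWeight to monomial)

  -- The record status r stays arbitrary and drops out of the result: this is where v₁ = y₁ enters.
  valleyStepWeight : ∀ r r′ → stepWeight r false false true false true false r′ true false false ≈ y₁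
  valleyStepWeight false r′ = prove ρ (monomial false false false true false true false r′ true false false) Y₁ refl
  valleyStepWeight true  r′ = prove ρ (monomial true false false true false true false r′ true false false) Y₁ refl

  riseStepWeight : ∀ r h → stepWeight r false true false false true false h true false false ≈ (if h then ŷ₂ else v̂₂)
  riseStepWeight false false = prove ρ (monomial false false true false false true false false true false false) V̂₂ refl
  riseStepWeight false true  = prove ρ (monomial false false true false false true false true true false false) Ŷ₂ refl
  riseStepWeight true  false = prove ρ (monomial true false true false false true false false true false false) V̂₂ refl
  riseStepWeight true  true  = prove ρ (monomial true false true false false true false true true false false) Ŷ₂ refl

  -- One Boolean b serves for record and antirecord, because a fixed point is both or neither
  -- according to whether paths are open; see `fixWeight`.
  oddFixStepWeight : ∀ b r′ → stepWeight b b false false false false true r′ true false true ≈ λ′ * (if b then zₒ else wₒ)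
  oddFixStepWeight false r′ = prove ρ (monomial false false false false false false true r′ true false true) (Λ :* Wₒ) refl
  oddFixStepWeight true  r′ = prove ρ (monomial true true false false false false true r′ true false true) (Λ :* Zₒ) refl

  evenFixStepWeight : ∀ b r′ → stepWeight b b false false false false true r′ false true true ≈ λ′ * (if b then zₑ else wₑ)
  evenFixStepWeight false r′ = prove ρ (monomial false false false false false false true r′ false true true) (Λ :* Wₑ) refl
  evenFixStepWeight true  r′ = prove ρ (monomial true true false false false false true r′ false true true) (Λ :* Zₑ) refl

  fallStepWeight : ∀ h r′ → stepWeight false h false true true false false r′ false true false ≈ (if h then x₂ else u₂)
  fallStepWeight false r′ = prove ρ (monomial false false false true true false false r′ false true false) U₂ refl
  fallStepWeight true  r′ = prove ρ (monomial false true false true true false false r′ false true false) X₂ refl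

  peakStepWeight : ∀ h r′ m → stepWeight false h true false true false false r′ false true m ≈ (if h then x₁ else u₁) * gate m λ′
  peakStepWeight false r′ false = prove ρ (monomial false false true false true false false r′ false true false) (U₁ :* con 1) refl
  peakStepWeight false r′ true  = prove ρ (monomial false false true false true false false r′ false true true) (U₁ :* Λ) refl
  peakStepWeight true  r′ false = prove ρ (monomial false true true false true false false r′ false true false) (X₁ :* con 1) refl
  peakStepWeight true  r′ true  = prove ρ (monomial false true true false true false false r′ false true true) (X₁ :* Λ) refl

  pick : Carrier → Carrier → List ℕ → ℕ → Carrier
  pick a b L x = if isHead L x then a else b

  isEmpty : List ℕ → Bool
  isEmpty []      = true
  isEmpty (_ ∷ _) = false

  term-false : ∀ c {b} F → b ≡ false → c * (⟦ b ⟧ * F) ≈ 0#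
  term-false c F ≡.refl = trans (*-congˡ (zeroˡ F)) (zeroʳ c)

  term-true : ∀ {c w b} F → b ≡ true → w ≈ c → w * F ≈ c * (⟦ b ⟧ * F)
  term-true F ≡.refl e = *-cong e (sym (*-identityˡ F))

  weight-eval : ∀ s i {r a l g l′ g′ f r′ o e m} → isRecord s i ≡ r → isAntirecord s i ≡ a →
    (inv s i <ᵇ i) ≡ l → (i <ᵇ inv s i) ≡ g → (ap s i <ᵇ i) ≡ l′ → (i <ᵇ ap s i) ≡ g′ → (ap s i ≡ᵇ i) ≡ f →
    isRecord s (inv s i) ≡ r′ → isOdd i ≡ o → isEven i ≡ e → cycMax s i ≡ m →
    weight s i ≈ stepWeight r a l g l′ g′ f r′ o e m
  weight-eval s i ≡.refl ≡.refl ≡.refl ≡.refl ≡.refl ≡.refl ≡.refl ≡.refl ≡.refl ≡.refl ≡.refl = refl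

  -- Splitting the weight over the moves at one position

  module Step {s} (perm : IsDPermutation (length s) (ap s)) {i p S V E} (st : State i p S V E)
              (t≤N : suc i ≤ length s) (F : Carrier) where
    open IsDPermutation perm using (maps; odd-≤; even-≥) renaming (injective to ap-injective)
    open State st using (S-sorted; V-sorted; balanced; ∈S⁻; ∈V⁻; E∈S)
    private
      t = suc i
      f = ap s
      t-in : t within length s
      t-in = s≤s z≤n , t≤N

      agrees : ℕ → (ℕ → ℕ) → Bool
      agrees j q = agreeᵇ f j q

      agree-true : ∀ {j q} → Agree f j q → agrees j q ≡ true
      agree-true {j} {q} = reflects-true (agreeᵇ-reflects f j q)

      agree-false : ∀ {j q} → ¬ Agree f j q → agrees j q ≡ false
      agree-false {j} {q} = reflects-false (agreeᵇ-reflects f j q)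

      V-≢0 : ∀ {v} → v ∈ V → v ≢ 0
      V-≢0 v∈ ≡.refl with () ← proj₁ (proj₁ (∈V⁻ v∈))

      nonempty : (∃ (_∈ S) × ∃ (_∈ V)) ⊎ (isEmpty S ≡ true × (∀ {x} → ¬ x ∈ S) × (∀ {x} → ¬ x ∈ V))
      nonempty = go S V balanced
        where
        go : ∀ S V → length S ≡ length V → (∃ (_∈ S) × ∃ (_∈ V)) ⊎ (isEmpty S ≡ true × (∀ {x} → ¬ x ∈ S) × (∀ {x} → ¬ x ∈ V))
        go []      []      _ = inj₂ (≡.refl , (λ ()) , (λ ()))
        go (_ ∷ _) (_ ∷ _) _ = inj₁ ((_ , here ≡.refl) , (_ , here ≡.refl))

      isEmpty-false : ∀ {x L} → x ∈ L → isEmpty L ≡ false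
      isEmpty-false (here _)  = ≡.refl
      isEmpty-false (there _) = ≡.refl

      source? : (∃ λ j → j ∈ S × f j ≡ t) ⊎ (∀ {j} → j ∈ S → f j ≢ t)
      source? with any? (λ j → f j ℕ.≟ t) S
      ... | yes a = inj₁ (find a)
      ... | no ¬a = inj₂ (λ j∈ e → ¬a (lose j∈ e))

      sum-zero : ∀ {L} {c : ℕ → Carrier} {b : ℕ → Bool} → (∀ {x} → x ∈ L → b x ≡ false) → ∑ L (λ x → c x * (⟦ b x ⟧ * F)) ≈ 0#
      sum-zero {L} h = ∑-zero L (λ x∈ → term-false _ F (h x∈))

      only-first : ∀ {a b c d} → a ≈ b → c ≈ 0# → d ≈ 0# → a ≈ b + (c + d)
      only-first e z z′ = trans e (sym (trans (+-congˡ (trans (+-cong z z′) (+-identityˡ 0#))) (+-identityʳ _)))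

      only-second : ∀ {a b c d} → b ≈ 0# → a ≈ c → d ≈ 0# → a ≈ b + (c + d)
      only-second z e z′ = trans e (sym (trans (+-cong z (trans (+-congˡ z′) (+-identityʳ _))) (+-identityˡ _)))

      only-third : ∀ {a b c d} → b ≈ 0# → c ≈ 0# → a ≈ d → a ≈ b + (c + d)
      only-third z z′ e = trans e (sym (trans (+-cong z (trans (+-congʳ z′) (+-identityˡ _))) (+-identityˡ _)))

    module _ (agree : Agree f i p) where
      open Scan {s} perm st t≤N agree

      fixWeight : ∀ {o e} (w z : Carrier) → isOdd t ≡ o → isEven t ≡ e →
        (∀ b r′ → stepWeight b b false false false false true r′ o e true ≈ λ′ * (if b then z else w)) →
        f t ≡ t → weight s t ≈ λ′ * (if isEmpty S then z else w)
      fixWeight w z o e shape ft≡t =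
        trans (weight-eval s t record-iff antirecord-iff (≤⇒<ᵇ (ℕ.≤-reflexive (≡.sym inv-t))) (≤⇒<ᵇ (ℕ.≤-reflexive inv-t))
                (≤⇒<ᵇ (ℕ.≤-reflexive (≡.sym ft≡t))) (≤⇒<ᵇ (ℕ.≤-reflexive ft≡t)) (reflects-true (≡ᵇ-reflects-≡ _ _) ft≡t)
                ≡.refl o e (cycMax-fixed ft≡t))
              (shape (isEmpty S) (isRecord s (inv s t)))
        where
        inv-t : inv s t ≡ t
        inv-t = ≡.trans (≡.cong (inv s) (≡.sym ft≡t)) (Cycles.inv-ap s maps ap-injective t-in)
        record-iff : isRecord s t ≡ isEmpty S
        record-iff with nonempty
        ... | inj₁ ((_ , x∈) , _) = ≡.trans (¬record-below x∈ (ℕ.≤-reflexive ft≡t)) (≡.sym (isEmpty-false x∈))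
        ... | inj₂ (e , none , _) = ≡.trans (record-closed none ft≡t) (≡.sym e)
        antirecord-iff : isAntirecord s t ≡ isEmpty S
        antirecord-iff with nonempty
        ... | inj₁ ((_ , x∈) , (_ , v∈)) = ≡.trans (¬antirecord-above v∈ (ℕ.≤-reflexive (≡.sym ft≡t))) (≡.sym (isEmpty-false x∈))
        ... | inj₂ (e , _ , none) = ≡.trans (antirecord-closed none ft≡t) (≡.sym e)

      fix-source-free : f t ≡ t → ∀ {j} → j ∈ S → f j ≢ t
      fix-source-free ft≡t j∈ e =
        ℕ.<⇒≢ (S-< st j∈) (ap-injective (within-N (proj₁ (∈S⁻ j∈))) t-in (≡.trans e (≡.sym ft≡t)))

    -- `F` will be the weight of the later positions. If s agrees with p, exactly one summand
    -- survives, and its coefficient is the weight of t in s; if not, s agrees with none of the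
    -- extended maps and both sides vanish. The summands are the valley, the rises and the fixed
    -- point.
    oddStep : isOdd t ≡ true → isEven t ≡ false →
      ⟦ agrees i p ⟧ * (weight s t * F) ≈
        y₁ * (⟦ agrees t p ⟧ * F)
      + (∑ S (λ j → pick ŷ₂ v̂₂ S j * (⟦ agrees t (p [ j ↦ t ]) ⟧ * F))
      + λ′ * (if isEmpty S then zₒ else wₒ) * (⟦ agrees t (p [ t ↦ t ]) ⟧ * F))
    oddStep odd even with agreeᵇ f i p in eq
    ... | false = trans (zeroˡ _) (only-first (sym (term-false _ F (agree-false (¬agree ∘ proj₁ ∘ Agree-open st))))
                    (sum-zero (λ j∈ → agree-false (¬agree ∘ proj₁ ∘ Agree-source st j∈)))
                    (term-false _ F (agree-false (¬agree ∘ proj₁ ∘ Agree-image st (λ ())))))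
      where
      ¬agree : ¬ Agree f i p
      ¬agree a with () ← ≡.trans (≡.sym eq) (agree-true a)
    ... | true = trans (*-identityˡ _) (cases (ℕ.m≤n⇒m<n∨m≡n (odd-≤ t-in odd)) source?)
      where
      agree = reflects-sound (agreeᵇ-reflects f i p) eq
      open Scan {s} perm st t≤N agree
      cases : t < f t ⊎ t ≡ f t → (∃ λ j → j ∈ S × f j ≡ t) ⊎ (∀ {j} → j ∈ S → f j ≢ t) → _
      cases (inj₁ t<ft) (inj₂ free) = only-first
        (term-true F (agree-true (Agree-open⁺ st t<ft free agree))
          (trans (weight-eval s t ≡.refl (¬antirecord-valley free t<ft) (≤⇒<ᵇ (ℕ.<⇒≤ t<inv)) (<⇒<ᵇ t<inv)
                   (≤⇒<ᵇ (ℕ.<⇒≤ t<ft)) (<⇒<ᵇ t<ft) (≢⇒≡ᵇ ft≢t) ≡.refl odd even (¬cycMax-excedance t<ft))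
                 (valleyStepWeight (isRecord s t) (isRecord s (inv s t)))))
        (sum-zero (λ j∈ → agree-false (λ a → free j∈ (proj₂ (proj₂ (Agree-source st j∈ a))))))
        (term-false _ F (agree-false (λ a → ft≢t (proj₁ (proj₂ (Agree-image st (λ ()) a))))))
        where
        ft≢t = ℕ.<⇒≢ t<ft ∘ ≡.sym
        t<inv = inv-later free ft≢t
      cases (inj₁ t<ft) (inj₁ (j , j∈ , fj≡t)) = only-second
        (term-false _ F (agree-false (λ a → proj₂ (proj₂ (Agree-open st a)) j∈ fj≡t)))
        (trans
          (term-true F (agree-true (Agree-source⁺ st j∈ t<ft fj≡t (source-unique j∈ fj≡t) agree))
            (trans (weight-eval s t ≡.refl (antirecord nonempty) (<⇒<ᵇ inv<t) (≤⇒<ᵇ (ℕ.<⇒≤ inv<t))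
                     (≤⇒<ᵇ (ℕ.<⇒≤ t<ft)) (<⇒<ᵇ t<ft) (≢⇒≡ᵇ ft≢t)
                     (≡.trans (≡.cong (isRecord s) inv≡j) (record-source j∈ fj≡t)) odd even (¬cycMax-excedance t<ft))
                   (riseStepWeight (isRecord s t) (isHead S j))))
          (sym (∑-single (sorted⇒unique S-sorted) j∈ λ {x} x∈ x≢j →
            term-false _ F (agree-false (λ a → x≢j (source-unique j∈ fj≡t x∈ (proj₂ (proj₂ (Agree-source st x∈ a)))))))))
        (term-false _ F (agree-false (λ a → ft≢t (proj₁ (proj₂ (Agree-image st (λ ()) a))))))
        where
        ft≢t = ℕ.<⇒≢ t<ft ∘ ≡.sym
        inv≡j = inv-source j∈ fj≡t
        inv<t = ≡.subst (_< t) (≡.sym inv≡j) (S-< st j∈)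
        antirecord : (∃ (_∈ S) × ∃ (_∈ V)) ⊎ (isEmpty S ≡ true × (∀ {x} → ¬ x ∈ S) × (∀ {x} → ¬ x ∈ V)) → isAntirecord s t ≡ false
        antirecord (inj₁ (_ , (_ , v∈)))  = ¬antirecord-above v∈ (ℕ.<⇒≤ t<ft)
        antirecord (inj₂ (_ , none , _)) = contradiction j∈ none
      cases (inj₂ t≡ft) _ = only-third
        (term-false _ F (agree-false (λ a → ℕ.<⇒≢ (proj₁ (proj₂ (Agree-open st a))) t≡ft)))
        (sum-zero (λ j∈ → agree-false (λ a → ℕ.<⇒≢ (proj₁ (proj₂ (Agree-source st j∈ a))) t≡ft)))
        (term-true F (agree-true (Agree-image⁺ st (λ ()) (≡.sym t≡ft) (fix-source-free agree (≡.sym t≡ft)) agree))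
          (fixWeight agree wₒ zₒ odd even oddFixStepWeight (≡.sym t≡ft)))

    -- As for odd positions, with the peaks, the falls and the fixed point. In a peak, t joins the
    -- end j of some path to the start v of some path; the gate charges λ when these are the same
    -- path.
    evenStep : isOdd t ≡ false → isEven t ≡ true →
      ⟦ agrees i p ⟧ * (weight s t * F) ≈
        ∑ V (λ v → ∑ S (λ j → pick x₁ u₁ V v * gate (E v ≡ᵇ j) λ′ * (⟦ agrees t (p [ t ↦ v ] [ j ↦ t ]) ⟧ * F)))
      + (∑ V (λ v → pick x₂ u₂ V v * (⟦ agrees t (p [ t ↦ v ]) ⟧ * F))
      + λ′ * (if isEmpty S then zₑ else wₑ) * (⟦ agrees t (p [ t ↦ t ]) ⟧ * F))
    evenStep odd even with agreeᵇ f i p in eq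
    ... | false = trans (zeroˡ _) (only-first
                    (sym (∑-zero V (λ v∈ → sum-zero (λ j∈ → agree-false (¬agree ∘ proj₁ ∘ Agree-both st (V-≢0 v∈) j∈)))))
                    (sum-zero (λ v∈ → agree-false (¬agree ∘ proj₁ ∘ Agree-image st (V-≢0 v∈))))
                    (term-false _ F (agree-false (¬agree ∘ proj₁ ∘ Agree-image st (λ ())))))
      where
      ¬agree : ¬ Agree f i p
      ¬agree a with () ← ≡.trans (≡.sym eq) (agree-true a)
    ... | true = trans (*-identityˡ _) (cases (ℕ.m≤n⇒m<n∨m≡n (even-≥ t-in odd)) source?)
      where
      agree = reflects-sound (agreeᵇ-reflects f i p) eq
      open Scan {s} perm st t≤N agree
      module _ (ft<t : f t < t) where
        ft∈V : f t ∈ V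
        ft∈V = preimage-V ℕ.≤-refl t≤N (ℕ.≤-pred ft<t)
        ¬record : isRecord s t ≡ false
        ¬record with nonempty
        ... | inj₁ ((_ , x∈) , _)  = ¬record-below x∈ (ℕ.<⇒≤ ft<t)
        ... | inj₂ (_ , _ , none) = contradiction ft∈V none
        ft≢t = ℕ.<⇒≢ ft<t
      cases : f t < t ⊎ f t ≡ t → (∃ λ j → j ∈ S × f j ≡ t) ⊎ (∀ {j} → j ∈ S → f j ≢ t) → _
      cases (inj₁ ft<t) (inj₁ (j , j∈ , fj≡t)) = only-first
        (trans
          (term-true F (agree-true (Agree-both⁺ st (V-≢0 v∈) j∈ ≡.refl fj≡t (source-unique j∈ fj≡t) agree))
            (trans (weight-eval s t (¬record ft<t) (antirecord-image v∈) (<⇒<ᵇ inv<t) (≤⇒<ᵇ (ℕ.<⇒≤ inv<t))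
                     (<⇒<ᵇ ft<t) (≤⇒<ᵇ (ℕ.<⇒≤ ft<t)) (≢⇒≡ᵇ (ft≢t ft<t)) ≡.refl odd even closes)
                   (peakStepWeight (isHead V (f t)) (isRecord s (inv s t)) (E (f t) ≡ᵇ j))))
          (sym (trans
            (∑-single (sorted⇒unique V-sorted) v∈ λ {w} w∈ w≢v →
              sum-zero (λ x∈ → agree-false (λ a → w≢v (≡.sym (proj₁ (proj₂ (Agree-both st (V-≢0 w∈) x∈ a)))))))
            (∑-single (sorted⇒unique S-sorted) j∈ λ {x} x∈ x≢j →
              term-false _ F (agree-false (λ a → x≢j (source-unique j∈ fj≡t x∈ (proj₂ (proj₂ (Agree-both st (V-≢0 v∈) x∈ a))))))))))
        (sum-zero (λ w∈ → agree-false (λ a → proj₂ (proj₂ (Agree-image st (V-≢0 w∈) a)) j∈ fj≡t)))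
        (term-false _ F (agree-false (λ a → ft≢t ft<t (proj₁ (proj₂ (Agree-image st (λ ()) a))))))
        where
        v∈ = ft∈V ft<t
        inv≡j = inv-source j∈ fj≡t
        inv<t = ≡.subst (_< t) (≡.sym inv≡j) (S-< st j∈)
        closes : cycMax s t ≡ (E (f t) ≡ᵇ j)
        closes with E (f t) ℕ.≟ j
        ... | yes ≡.refl = ≡.trans (cycMax-closed v∈ fj≡t) (≡.sym (≡ᵇ-refl j))
        ... | no e≢j     = ≡.trans (¬cycMax-open v∈ (λ e → e≢j (source-unique j∈ fj≡t (E∈S v∈) e))) (≡.sym (≢⇒≡ᵇ e≢j))
      cases (inj₁ ft<t) (inj₂ free) = only-second
        (∑-zero V (λ w∈ → sum-zero (λ x∈ → agree-false (λ a → free x∈ (proj₂ (proj₂ (Agree-both st (V-≢0 w∈) x∈ a)))))))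
        (trans
          (term-true F (agree-true (Agree-image⁺ st (V-≢0 v∈) ≡.refl free agree))
            (trans (weight-eval s t (¬record ft<t) (antirecord-image v∈) (≤⇒<ᵇ (ℕ.<⇒≤ t<inv)) (<⇒<ᵇ t<inv)
                     (<⇒<ᵇ ft<t) (≤⇒<ᵇ (ℕ.<⇒≤ ft<t)) (≢⇒≡ᵇ (ft≢t ft<t)) ≡.refl odd even (¬cycMax-open v∈ (free (E∈S v∈))))
                   (fallStepWeight (isHead V (f t)) (isRecord s (inv s t)))))
          (sym (∑-single (sorted⇒unique V-sorted) v∈ λ {w} w∈ w≢v →
            term-false _ F (agree-false (λ a → w≢v (≡.sym (proj₁ (proj₂ (Agree-image st (V-≢0 w∈) a)))))))))
        (term-false _ F (agree-false (λ a → ft≢t ft<t (proj₁ (proj₂ (Agree-image st (λ ()) a))))))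
        where
        v∈ = ft∈V ft<t
        t<inv = inv-later free (ft≢t ft<t)
      cases (inj₂ ft≡t) _ = only-third
        (∑-zero V (λ w∈ → sum-zero (λ x∈ → agree-false (λ a →
          ft∉V w∈ (proj₁ (proj₂ (Agree-both st (V-≢0 w∈) x∈ a)))))))
        (sum-zero (λ w∈ → agree-false (λ a → ft∉V w∈ (proj₁ (proj₂ (Agree-image st (V-≢0 w∈) a))))))
        (term-true F (agree-true (Agree-image⁺ st (λ ()) ft≡t (fix-source-free agree ft≡t) agree))
          (fixWeight agree wₑ zₑ odd even evenFixStepWeight ft≡t))
        where
        ft∉V : ∀ {w} → w ∈ V → f t ≢ w
        ft∉V w∈ e = ℕ.<⇒≢ (V-< st w∈) (≡.trans (≡.sym e) ft≡t)

-- Continued fractions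

module ContinuedFraction {c ℓ} (R : CommutativeRing c ℓ) where
  open CommutativeRing R
  open WithRing R
  open import Relation.Binary.Reasoning.Setoid setoid
  open import Algebra.Solver.Ring.NaturalCoefficients.Default commutativeSemiring using (solve; con; _:+_; _:*_; _:=_)

  infixl 7 _⋆_
  -- Cauchy product by recursion on the left factor, the order in which `conv` runs through its
  -- coefficients.
  _⋆_ : Series → Series → Series
  (f ⋆ g) zero    = f 0 * g 0
  (f ⋆ g) (suc n) = f 0 * g (suc n) + ((f ∘ suc) ⋆ g) n

  -- Agreement up to n must suffice, since truncations of a continued fraction agree only up to some
  -- order.
  ⋆-cong : ∀ n {f f′ g g′ : Series} → (∀ m → m ℕ.≤ n → f m ≈ f′ m) → (∀ m → m ℕ.≤ n → g m ≈ g′ m) →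
           (f ⋆ g) n ≈ (f′ ⋆ g′) n
  ⋆-cong zero    p q = *-cong (p 0 z≤n) (q 0 z≤n)
  ⋆-cong (suc n) p q = +-cong (*-cong (p 0 z≤n) (q (suc n) ℕ.≤-refl))
                              (⋆-cong n (λ m m≤n → p (suc m) (s≤s m≤n)) (λ m m≤n → q m (ℕ.m≤n⇒m≤1+n m≤n)))

  ⋆-linearˡ : ∀ a b (f g h : Series) n →
              ((λ m → a * f m + b * g m) ⋆ h) n ≈ a * (f ⋆ h) n + b * (g ⋆ h) n
  ⋆-linearˡ a b f g h zero    = lemma a b (f 0) (g 0) (h 0)
    where lemma : ∀ a b x y z → (a * x + b * y) * z ≈ a * (x * z) + b * (y * z)
          lemma = solve 5 (λ a b x y z → (a :* x :+ b :* y) :* z := a :* (x :* z) :+ b :* (y :* z)) refl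
  ⋆-linearˡ a b f g h (suc n) =
    trans (+-congˡ (⋆-linearˡ a b (f ∘ suc) (g ∘ suc) h n)) (lemma a b (f 0) (g 0) (h (suc n)) _ _)
    where lemma : ∀ a b x y z u v → (a * x + b * y) * z + (a * u + b * v) ≈ a * (x * z + u) + b * (y * z + v)
          lemma = solve 7 (λ a b x y z u v → (a :* x :+ b :* y) :* z :+ (a :* u :+ b :* v) := a :* (x :* z :+ u) :+ b :* (y :* z :+ v)) refl

  ⋆-scaleʳ : ∀ a f g n → a * (f ⋆ g) n ≈ (f ⋆ (λ m → a * g m)) n
  ⋆-scaleʳ a f g zero    = solve 3 (λ a x y → a :* (x :* y) := x :* (a :* y)) refl a (f 0) (g 0)
  ⋆-scaleʳ a f g (suc n) = trans
    (solve 4 (λ a x y z → a :* (x :* y :+ z) := x :* (a :* y) :+ a :* z) refl a (f 0) (g (suc n)) _)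
    (+-congˡ (⋆-scaleʳ a (f ∘ suc) g n))

  ⋆-assoc : ∀ f g h n → ((f ⋆ g) ⋆ h) n ≈ (f ⋆ (g ⋆ h)) n
  ⋆-assoc f g h zero    = *-assoc _ _ _
  ⋆-assoc f g h (suc n) = begin
    f 0 * g 0 * h (suc n) + ((λ m → f 0 * g (suc m) + ((f ∘ suc) ⋆ g) m) ⋆ h) n
      ≈⟨ +-congˡ (⋆-cong n (λ m _ → +-congˡ (sym (*-identityˡ _))) (λ _ _ → refl)) ⟩
    f 0 * g 0 * h (suc n) + ((λ m → f 0 * g (suc m) + 1# * ((f ∘ suc) ⋆ g) m) ⋆ h) n
      ≈⟨ +-congˡ (⋆-linearˡ (f 0) 1# (g ∘ suc) ((f ∘ suc) ⋆ g) h n) ⟩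
    f 0 * g 0 * h (suc n) + (f 0 * ((g ∘ suc) ⋆ h) n + 1# * (((f ∘ suc) ⋆ g) ⋆ h) n)
      ≈⟨ lemma _ _ _ _ _ ⟩
    f 0 * (g 0 * h (suc n) + ((g ∘ suc) ⋆ h) n) + (((f ∘ suc) ⋆ g) ⋆ h) n
      ≈⟨ +-congˡ (⋆-assoc (f ∘ suc) g h n) ⟩
    f 0 * (g 0 * h (suc n) + ((g ∘ suc) ⋆ h) n) + ((f ∘ suc) ⋆ (g ⋆ h)) n ∎
    where lemma : ∀ a b c d e → a * b * c + (a * d + 1# * e) ≈ a * (b * c + d) + e
          lemma = solve 5 (λ a b c d e → a :* b :* c :+ (a :* d :+ con 1 :* e) := a :* (b :* c :+ d) :+ e) refl

  ⋆-shiftT : ∀ f g n → (f ⋆ shiftT g) (suc n) ≈ (f ⋆ g) n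
  ⋆-shiftT f g zero    = trans (+-congˡ (zeroʳ _)) (+-identityʳ _)
  ⋆-shiftT f g (suc n) = +-congˡ (⋆-shiftT (f ∘ suc) g n)

  zero-⋆ : ∀ g n → ((λ _ → 0#) ⋆ g) n ≈ 0#
  zero-⋆ g zero    = zeroˡ _
  zero-⋆ g (suc n) = trans (+-cong (zeroˡ _) (zero-⋆ g n)) (+-identityˡ _)

  ⋆-zero : ∀ f g n → (∀ m → m ℕ.≤ n → g m ≈ 0#) → (f ⋆ g) n ≈ 0#
  ⋆-zero f g zero    z = trans (*-congˡ (z 0 z≤n)) (zeroʳ _)
  ⋆-zero f g (suc n) z = trans (+-cong (trans (*-congˡ (z (suc n) ℕ.≤-refl)) (zeroʳ _))
                                       (⋆-zero (f ∘ suc) g n (λ m m≤n → z m (ℕ.m≤n⇒m≤1+n m≤n)))) (+-identityˡ _)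

  one-⋆ : ∀ g n → (one ⋆ g) n ≈ g n
  one-⋆ g zero    = *-identityˡ _
  one-⋆ g (suc n) = trans (+-cong (*-identityˡ _) (zero-⋆ g n)) (+-identityʳ _)

  geom-suc : ∀ g n → geom g (suc n) ≈ ((g ∘ suc) ⋆ geom g) n
  geom-suc g n = go g 1 n
    where
    go : ∀ f k n → conv f k (geomPrefix g n) ≈ ((λ j → f (k ℕ.+ j)) ⋆ geom g) n
    go f k zero    = trans (+-identityʳ _) (*-congʳ (reflexive (≡.cong f (≡.sym (ℕ.+-identityʳ k)))))
    go f k (suc n) = +-cong (*-congʳ (reflexive (≡.cong f (≡.sym (ℕ.+-identityʳ k)))))
      (trans (go f (suc k) n) (⋆-cong n (λ j _ → reflexive (≡.cong f (≡.sym (ℕ.+-suc k j)))) (λ _ _ → refl)))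

  module _ (α δ : ℕ → Carrier) where

    cfFrom-suc : ∀ d k n → cfFrom α δ (suc d) k (suc n) ≈
      δ k * cfFrom α δ (suc d) k n + α k * (cfFrom α δ d (suc k) ⋆ cfFrom α δ (suc d) k) n
    cfFrom-suc d k n = trans (geom-suc _ n)
      (trans (⋆-linearˡ (δ k) (α k) one (cfFrom α δ d (suc k)) _ n) (+-congʳ (*-congˡ (one-⋆ _ n))))

    -- Every level brings a factor t, so the levels from depth d on affect no coefficient below t^d.
    -- The level k itself recurs on the right of `cfFrom-suc`, hence the strong induction `go` on
    -- the coefficient inside the induction on depth.
    cfFrom-deepen : ∀ d k n → n ℕ.< d → cfFrom α δ d k n ≈ cfFrom α δ (suc d) k n
    cfFrom-deepen (suc d) k n n<d = go n n n<d ℕ.≤-refl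
      where
      go : ∀ n m → n ℕ.< suc d → m ℕ.≤ n → cfFrom α δ (suc d) k m ≈ cfFrom α δ (suc (suc d)) k m
      go n zero    _ _ = refl
      go (suc n) (suc m) (s≤s n<d) (s≤s m≤n) = begin
        cfFrom α δ (suc d) k (suc m)
          ≈⟨ cfFrom-suc d k m ⟩
        _ ≈⟨ +-cong (*-congˡ (ih m ℕ.≤-refl))
               (*-congˡ (⋆-cong m (λ j j≤m → cfFrom-deepen d (suc k) j (ℕ.≤-<-trans j≤m (ℕ.≤-<-trans m≤n n<d))) ih)) ⟩
        _ ≈⟨ cfFrom-suc (suc d) k m ⟨
        cfFrom α δ (suc (suc d)) k (suc m) ∎
        where
        ih : ∀ j → j ℕ.≤ m → cfFrom α δ (suc d) k j ≈ cfFrom α δ (suc (suc d)) k j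
        ih j j≤m = go n j (ℕ.m≤n⇒m≤1+n n<d) (ℕ.≤-trans j≤m m≤n)

    -- The continued fraction from level h + 1 on: the generating function of the paths from height
    -- h back to h that stay at height h or above.
    tail : ℕ → Series
    tail h n = cfFrom α δ (suc n) (suc h) n

    cfFrom≈tail : ∀ d h n → n ℕ.< d → cfFrom α δ d (suc h) n ≈ tail h n
    cfFrom≈tail d h n n<d with ℕ.m≤n⇒∃[o]m+o≡n n<d
    ... | o , ≡.refl = go o
      where
      go : ∀ o → cfFrom α δ (suc n ℕ.+ o) (suc h) n ≈ tail h n
      go zero    = reflexive (≡.cong (λ d → cfFrom α δ d (suc h) n) (ℕ.+-identityʳ (suc n)))
      go (suc o) = trans (reflexive (≡.cong (λ d → cfFrom α δ d (suc h) n) (ℕ.+-suc (suc n) o)))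
        (trans (sym (cfFrom-deepen (suc n ℕ.+ o) (suc h) n (ℕ.m≤m+n (suc n) o))) (go o))

    tail-suc : ∀ h n → tail h (suc n) ≈ δ (suc h) * tail h n + α (suc h) * (tail (suc h) ⋆ tail h) n
    tail-suc h n = trans (cfFrom-suc (suc n) (suc h) n)
      (+-cong (*-congˡ (cfFrom≈tail _ h n (ℕ.m≤n⇒m≤1+n ℕ.≤-refl)))
              (*-congˡ (⋆-cong n (λ m m≤n → cfFrom≈tail _ (suc h) m (s≤s m≤n))
                                 (λ m m≤n → cfFrom≈tail _ h m (ℕ.m≤n⇒m≤1+n (s≤s m≤n))))))

    tail-⋆-suc : ∀ h g n → (tail h ⋆ g) (suc n) ≈
      g (suc n) + (δ (suc h) * (tail h ⋆ g) n + α (suc h) * (tail (suc h) ⋆ (tail h ⋆ g)) n)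
    tail-⋆-suc h g n = +-cong (*-identityˡ _) (begin
      ((tail h ∘ suc) ⋆ g) n
        ≈⟨ ⋆-cong n (λ m _ → tail-suc h m) (λ _ _ → refl) ⟩
      ((λ m → δ (suc h) * tail h m + α (suc h) * (tail (suc h) ⋆ tail h) m) ⋆ g) n
        ≈⟨ ⋆-linearˡ (δ (suc h)) (α (suc h)) _ _ g n ⟩
      δ (suc h) * (tail h ⋆ g) n + α (suc h) * ((tail (suc h) ⋆ tail h) ⋆ g) n
        ≈⟨ +-congˡ (*-congˡ (⋆-assoc (tail (suc h)) (tail h) g n)) ⟩
      δ (suc h) * (tail h ⋆ g) n + α (suc h) * (tail (suc h) ⋆ (tail h ⋆ g)) n ∎)

    -- Generating function, by number of falls, of the Schröder paths from height h to height 0: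
    -- cut such a path at its first descents to the heights h-1, …, 0.
    module Descent (up down : ℕ → Carrier) (α≈ : ∀ h → α (suc h) ≈ up h * down (suc h))
                   (δ≈0 : ∀ h → δ (suc (suc h)) ≈ 0#) where

      descent : ℕ → Series
      descent zero    = tail 0
      descent (suc h) = shiftT (λ n → down (suc h) * (tail (suc h) ⋆ descent h) n)

      descent-< : ∀ h n → n ℕ.< h → descent h n ≈ 0#
      descent-< (suc h) zero    _         = refl
      descent-< (suc h) (suc n) (s≤s n<h) =
        trans (*-congˡ (⋆-zero _ _ n (λ m m≤n → descent-< h m (ℕ.≤-<-trans m≤n n<h)))) (zeroʳ _)

      descent-zero-suc : ∀ n → descent 0 (suc n) ≈ δ 1 * descent 0 n + up 0 * descent 1 (suc n)
      descent-zero-suc n = trans (tail-suc 0 n) (+-congˡ (trans (*-congʳ (α≈ 0)) (*-assoc _ _ _)))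

      -- Decomposition by the first step. In `tail-⋆-suc` the isolated summand is the path that
      -- falls at once. In the other one α splits into a first rise and the later fall back; with
      -- that fall, the remainder is a descent from one level higher.
      descent-suc-suc : ∀ h n → descent (suc h) (suc n) ≈
                        down (suc h) * descent h n + up (suc h) * descent (suc (suc h)) (suc n)
      descent-suc-suc h zero    = begin
        down (suc h) * (1# * descent h 0) ≈⟨ lemma _ _ _ _ _ ⟩
        down (suc h) * descent h 0 + up (suc h) * (down (suc (suc h)) * (tail (suc (suc h)) 0 * 0#)) ∎
        where lemma : ∀ a b c d e → a * (1# * b) ≈ a * b + c * (d * (e * 0#))
              lemma = solve 5 (λ a b c d e → a :* (con 1 :* b) := a :* b :+ c :* (d :* (e :* con 0))) refl
      descent-suc-suc h (suc n) = begin
        a * (F ⋆ G) (suc n)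
          ≈⟨ *-congˡ (tail-⋆-suc (suc h) G n) ⟩
        a * (G (suc n) + (δ (suc (suc h)) * (F ⋆ G) n + α (suc (suc h)) * (F′ ⋆ (F ⋆ G)) n))
          ≈⟨ *-congˡ (+-congˡ (+-cong (*-congʳ (δ≈0 h)) (*-congʳ (α≈ (suc h))))) ⟩
        a * (G (suc n) + (0# * (F ⋆ G) n + b * d * (F′ ⋆ (F ⋆ G)) n))
          ≈⟨ lemma _ _ _ _ _ _ ⟩
        a * G (suc n) + b * (d * (a * (F′ ⋆ (F ⋆ G)) n))
          ≈⟨ +-congˡ (*-congˡ (*-congˡ (⋆-scaleʳ a F′ (F ⋆ G) n))) ⟩
        a * G (suc n) + b * (d * (F′ ⋆ (λ m → a * (F ⋆ G) m)) n)
          ≈⟨ +-congˡ (*-congˡ (*-congˡ (⋆-shiftT F′ _ n))) ⟨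
        a * G (suc n) + b * (d * (F′ ⋆ descent (suc h)) (suc n)) ∎
        where
        a = down (suc h)
        b = up (suc h)
        d = down (suc (suc h))
        F = tail (suc h)
        F′ = tail (suc (suc h))
        G = descent h
        lemma : ∀ a b d g x y → a * (g + (0# * x + b * d * y)) ≈ a * g + b * (d * (a * y))
        lemma = solve 6 (λ a b d g x y → a :* (g :+ (con 0 :* x :+ b :* d :* y)) := a :* g :+ b :* (d :* (a :* y))) refl

-- Parity and halving of indices

isOdd-2k : ∀ k → isOdd (k ℕ.* 2) ≡ false
isOdd-2k k = ≡.cong (ℕ._≡ᵇ 1) (ℕ.m*n%n≡0 k 2)

isOdd-2k+1 : ∀ k → isOdd (suc (k ℕ.* 2)) ≡ true
isOdd-2k+1 k = ≡.cong (ℕ._≡ᵇ 1) (ℕ.[m+kn]%n≡m%n 1 k 2)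

half-2k+2 : ∀ k → (suc (k ℕ.* 2) ℕ.+ 1) ℕ./ 2 ≡ suc k
half-2k+2 k = ≡.trans (≡.cong (ℕ._/ 2) (ℕ.+-comm (suc (k ℕ.* 2)) 1)) (ℕ.m*n/n≡m (suc k) 2)

half-2k+3 : ∀ k → (suc (suc (k ℕ.* 2)) ℕ.+ 1) ℕ./ 2 ≡ suc k
half-2k+3 k = ≡.trans (≡.cong (ℕ._/ 2) (ℕ.+-comm (suc k ℕ.* 2) 1))
  (≡.trans (ℕ.+-distrib-/ 1 (suc k ℕ.* 2) (≡.subst (λ r → 1 ℕ.+ r ℕ.< 2) (≡.sym (ℕ.m*n%n≡0 (suc k) 2)) ℕ.≤-refl))
           (ℕ.m*n/n≡m (suc k) 2))

interleave : ∀ {a} {A : Set a} → (ℕ → A) → (ℕ → A) → ℕ → A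
interleave f g zero    = f 0
interleave f g (suc n) = interleave g (f ∘ suc) n

interleave-2k : ∀ {a} {A : Set a} (f g : ℕ → A) k → interleave f g (k ℕ.* 2) ≡ f k
interleave-2k f g zero    = ≡.refl
interleave-2k f g (suc k) = interleave-2k (f ∘ suc) (g ∘ suc) k

interleave-2k+1 : ∀ {a} {A : Set a} (f g : ℕ → A) k → interleave f g (suc (k ℕ.* 2)) ≡ g k
interleave-2k+1 f g k = interleave-2k g (f ∘ suc) k

parity : ∀ h → ∃ λ k → h ≡ k ℕ.* 2 ⊎ h ≡ suc (k ℕ.* 2)
parity zero = 0 , inj₁ ≡.refl
parity (suc h) with parity h
... | k , inj₁ e = k , inj₂ (≡.cong suc e)
... | k , inj₂ e = suc k , inj₁ (≡.cong suc e)

-- Transfer recursion and heights of paths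

module Transfer {c ℓ} (R : CommutativeRing c ℓ)
                (x₁ x₂ y₁ ŷ₂ u₁ u₂ v̂₂ wₑ wₒ zₑ zₒ λ′ : CommutativeRing.Carrier R) where
  open CommutativeRing R
  open WithRing R
  open ContinuedFraction R
  open import Relation.Binary.Reasoning.Setoid setoid
  open import Algebra.Solver.Ring.NaturalCoefficients.Default commutativeSemiring using (solve; _:+_; _:*_; _:=_)

  -- `peakWeight k` belongs to the step from k + 1 open paths to k; the other two are indexed by the
  -- number of open paths. At 0 only a fixed point is possible, and it is a record-antirecord.
  peakWeight fallOrFixWeight riseOrFixWeight : ℕ → Carrier
  peakWeight k = (λ′ + nat k) * (x₁ + nat k * u₁)
  fallOrFixWeight zero    = λ′ * zₑ
  fallOrFixWeight (suc k) = x₂ + nat k * u₂ + λ′ * wₑ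
  riseOrFixWeight zero    = λ′ * zₒ
  riseOrFixWeight (suc k) = ŷ₂ + nat k * v̂₂ + λ′ * wₒ

  -- Total weight of the ways to process the last 2m (beforeOdd) or 2m + 1 (beforeEven) positions
  -- when k paths of the permutation graph are open.
  beforeOdd beforeEven : ℕ → ℕ → Carrier
  beforeOdd zero    zero    = 1#
  beforeOdd zero    (suc k) = 0#
  beforeOdd (suc m) k       = y₁ * beforeEven m (suc k) + riseOrFixWeight k * beforeEven m k
  beforeEven m zero    = fallOrFixWeight 0 * beforeOdd m 0
  beforeEven m (suc k) = peakWeight k * beforeOdd m k + fallOrFixWeight (suc k) * beforeOdd m (suc k)

  private
    -- With k open paths the height is 2k before an odd and 2k - 1 before an even position. So
    -- valleys go up from even heights, falls and even fixed points up from odd ones; peaks go down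
    -- from odd heights, rises and odd fixed points down from even ones. `down zero` is a default
    -- value.
    α δ up down : ℕ → Carrier
    α = alpha42 x₁ x₂ y₁ ŷ₂ u₁ u₂ v̂₂ wₑ wₒ λ′
    δ = delta42 zₑ zₒ λ′
    up = interleave (λ _ → y₁) (fallOrFixWeight ∘ suc)
    down zero    = 0#
    down (suc h) = interleave peakWeight (riseOrFixWeight ∘ suc) h

    α≈ : ∀ h → α (suc h) ≈ up h * down (suc h)
    α≈ h with parity h
    ... | k , inj₁ ≡.refl rewrite isOdd-2k+1 k | half-2k+2 k
            | interleave-2k (λ _ → y₁) (fallOrFixWeight ∘ suc) k
            | interleave-2k peakWeight (riseOrFixWeight ∘ suc) k = *-comm _ _
    ... | k , inj₂ ≡.refl rewrite isOdd-2k (suc k) | half-2k+3 k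
            | interleave-2k+1 (λ _ → y₁) (fallOrFixWeight ∘ suc) k
            | interleave-2k+1 peakWeight (riseOrFixWeight ∘ suc) k = refl

  open Descent α δ up down α≈ (λ _ → refl)

  -- `descent` counts falls: 2m steps from height 2k to 0 contain m + k of them, and so do 2m + 1
  -- steps from height 2k + 1, with k + 1 in place of k. A level step at height 0 takes two
  -- positions and counts as one fall.
  beforeOdd≈descent : ∀ m k → beforeOdd m k ≈ descent (k ℕ.* 2) (m ℕ.+ k)
  beforeEven≈descent : ∀ m k → beforeEven m (suc k) ≈ descent (suc (k ℕ.* 2)) (m ℕ.+ suc k)

  beforeOdd≈descent zero    zero    = refl
  beforeOdd≈descent zero    (suc k) = sym (descent-< (suc k ℕ.* 2) (suc k) (s≤s (s≤s (ℕ.m≤m*n k 2))))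
  -- With no path open, an odd fixed point would lead to height -1, where only an even fixed point
  -- can follow. The pair of them is the level step with weight δ₁.
  beforeOdd≈descent (suc m) zero    = begin
    y₁ * beforeEven m 1 + λ′ * zₒ * (λ′ * zₑ * beforeOdd m 0)
      ≈⟨ +-cong (*-congˡ (beforeEven≈descent m 0)) (*-congˡ (*-congˡ (beforeOdd≈descent m 0))) ⟩
    y₁ * descent 1 (m ℕ.+ 1) + λ′ * zₒ * (λ′ * zₑ * descent 0 (m ℕ.+ 0))
      ≡⟨ ≡.cong (λ j → y₁ * descent 1 j + λ′ * zₒ * (λ′ * zₑ * descent 0 (m ℕ.+ 0))) (ℕ.+-suc m 0) ⟩
    y₁ * descent 1 (suc (m ℕ.+ 0)) + λ′ * zₒ * (λ′ * zₑ * descent 0 (m ℕ.+ 0))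
      ≈⟨ solve 6 (λ l e o y a b → y :* b :+ l :* o :* (l :* e :* a) := l :* l :* e :* o :* a :+ y :* b)
           refl λ′ zₑ zₒ y₁ _ _ ⟩
    δ 1 * descent 0 (m ℕ.+ 0) + y₁ * descent 1 (suc (m ℕ.+ 0))
      ≈⟨ descent-zero-suc (m ℕ.+ 0) ⟨
    descent 0 (suc (m ℕ.+ 0)) ∎
  beforeOdd≈descent (suc m) (suc k) = begin
    y₁ * beforeEven m (suc (suc k)) + riseOrFixWeight (suc k) * beforeEven m (suc k)
      ≈⟨ +-cong (*-congˡ (beforeEven≈descent m (suc k))) (*-congˡ (beforeEven≈descent m k)) ⟩
    y₁ * descent (suc (suc k ℕ.* 2)) (m ℕ.+ suc (suc k)) + riseOrFixWeight (suc k) * descent (suc (k ℕ.* 2)) (m ℕ.+ suc k)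
      ≈⟨ +-comm _ _ ⟩
    riseOrFixWeight (suc k) * descent (suc (k ℕ.* 2)) (m ℕ.+ suc k) + y₁ * descent (suc (suc k ℕ.* 2)) (m ℕ.+ suc (suc k))
      ≡⟨ ≡.cong₂ _+_ (≡.cong (_* descent (suc (k ℕ.* 2)) (m ℕ.+ suc k))
                        (≡.sym (interleave-2k+1 peakWeight (riseOrFixWeight ∘ suc) k)))
                     (≡.cong₂ _*_ (≡.sym (interleave-2k (λ _ → y₁) (fallOrFixWeight ∘ suc) (suc k)))
                                  (≡.cong (descent (suc (suc k ℕ.* 2))) (ℕ.+-suc m (suc k)))) ⟩
    _ ≈⟨ descent-suc-suc (suc (k ℕ.* 2)) (m ℕ.+ suc k) ⟨
    descent (suc k ℕ.* 2) (suc (m ℕ.+ suc k)) ∎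

  beforeEven≈descent m k = begin
    peakWeight k * beforeOdd m k + fallOrFixWeight (suc k) * beforeOdd m (suc k)
      ≈⟨ +-cong (*-congˡ (beforeOdd≈descent m k)) (*-congˡ (beforeOdd≈descent m (suc k))) ⟩
    peakWeight k * descent (k ℕ.* 2) (m ℕ.+ k) + fallOrFixWeight (suc k) * descent (suc k ℕ.* 2) (m ℕ.+ suc k)
      ≡⟨ ≡.cong₂ _+_ (≡.cong (_* descent (k ℕ.* 2) (m ℕ.+ k))
                        (≡.sym (interleave-2k peakWeight (riseOrFixWeight ∘ suc) k)))
                     (≡.cong₂ _*_ (≡.sym (interleave-2k+1 (λ _ → y₁) (fallOrFixWeight ∘ suc) k))
                                  (≡.cong (descent (suc k ℕ.* 2)) (ℕ.+-suc m k))) ⟩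
    _ ≈⟨ descent-suc-suc (k ℕ.* 2) (m ℕ.+ k) ⟨
    descent (suc (k ℕ.* 2)) (suc (m ℕ.+ k))
      ≡⟨ ≡.cong (descent (suc (k ℕ.* 2))) (≡.sym (ℕ.+-suc m k)) ⟩
    descent (suc (k ℕ.* 2)) (m ℕ.+ suc k) ∎

  beforeOdd≈Tfrac : ∀ n → beforeOdd n 0 ≈ Tfrac α δ n
  beforeOdd≈Tfrac n = trans (beforeOdd≈descent n 0) (reflexive (≡.cong (descent 0) (ℕ.+-identityʳ n)))

-- The transfer recursion counts the extensions of a state

isEven-2k : ∀ k → isEven (k ℕ.* 2) ≡ true
isEven-2k k = ≡.cong (ℕ._≡ᵇ 0) (ℕ.m*n%n≡0 k 2)

isEven-2k+1 : ∀ k → isEven (suc (k ℕ.* 2)) ≡ false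
isEven-2k+1 k = ≡.cong (ℕ._≡ᵇ 0) (ℕ.[m+kn]%n≡m%n 1 k 2)

∈-∷ʳ-last : ∀ {t : ℕ} L → t ∈ L ∷ʳ t
∈-∷ʳ-last L = ∈-++⁺ʳ L (here ≡.refl)

module Main {c ℓ} (R : CommutativeRing c ℓ)
            (x₁ x₂ y₁ ŷ₂ u₁ u₂ v̂₂ wₑ wₒ zₑ zₒ λ′ : CommutativeRing.Carrier R) where
  open CommutativeRing R
  open WithRing R
  open Weights R x₁ x₂ y₁ ŷ₂ u₁ u₂ v̂₂ wₑ wₒ zₑ zₒ λ′
  open Transfer R x₁ x₂ y₁ ŷ₂ u₁ u₂ v̂₂ wₑ wₒ zₑ zₒ λ′
  open import Relation.Binary.Reasoning.Setoid setoid
  open import Algebra.Solver.Ring.NaturalCoefficients.Default commutativeSemiring using (solve; con; _:+_; _:=_)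

  remaining : List ℕ → ℕ → ℕ → Carrier
  remaining s i zero    = 1#
  remaining s i (suc r) = weight s (suc i) * remaining s (suc i) r

  ∏-range : ∀ s N → ∏ (range N) (weight s) ≈ remaining s 0 N
  ∏-range s N = go N 0 id (λ _ → ≡.refl)
    where
    go : ∀ r i (h : ℕ → ℕ) → (∀ j → h j ≡ i ℕ.+ j) → ∏ (map suc (applyUpTo h r)) (weight s) ≈ remaining s i r
    go zero    i h e = refl
    go (suc r) i h e = *-cong (reflexive (≡.cong (weight s ∘ suc) (≡.trans (e 0) (ℕ.+-identityʳ i))))
                              (go r (suc i) (h ∘ suc) (λ j → ≡.trans (e (suc j)) (ℕ.+-suc i j)))

  ∑-const : ∀ (L : List ℕ) a → ∑ L (λ _ → a) ≈ nat (length L) * a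
  ∑-const []      a = sym (zeroˡ a)
  ∑-const (_ ∷ L) a = trans (+-cong (sym (*-identityˡ a)) (∑-const L a)) (sym (distribʳ a 1# (nat (length L))))

  -- Origin of the factors such as x₁ + (k - 1)u₁: one choice is the least element and earns a, the
  -- others earn b.
  ∑-pick : ∀ a b {L k} → Sorted L → length L ≡ suc k → ∑ L (pick a b L) ≈ a + nat k * b
  ∑-pick a b {y ∷ L} (y< ∷ _) ≡.refl = +-cong
    (reflexive (≡.cong (if_then a else b) (≡ᵇ-refl y)))
    (trans (∑-cong L (λ x∈ → reflexive (≡.cong (if_then a else b) (≢⇒≡ᵇ (ℕ.>⇒≢ (All.lookup y< x∈)))))) (∑-const L b))

  -- Origin of the factor λ + k - 1: among the possible sources just one ends the path that would
  -- close up.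
  ∑-gate : ∀ {L e k} → Sorted L → e ∈ L → length L ≡ suc k → ∑ L (λ x → gate (e ≡ᵇ x) λ′) ≈ λ′ + nat k
  ∑-gate {y ∷ L} (y< ∷ _) (here ≡.refl) ≡.refl = +-cong
    (reflexive (≡.cong (λ b → gate b λ′) (≡ᵇ-refl y)))
    (trans (∑-cong L (λ x∈ → reflexive (≡.cong (λ b → gate b λ′) (≢⇒≡ᵇ (ℕ.<⇒≢ (All.lookup y< x∈))))))
           (trans (∑-const L 1#) (*-identityʳ _)))
  ∑-gate {y ∷ x ∷ L} (y< ∷ sorted) (there e∈) ≡.refl = trans
    (+-cong (reflexive (≡.cong (λ b → gate b λ′) (≢⇒≡ᵇ (ℕ.>⇒≢ (All.lookup y< e∈))))) (∑-gate sorted e∈ ≡.refl))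
    (solve 2 (λ l m → con 1 :+ (l :+ m) := l :+ (con 1 :+ m)) refl λ′ (nat (length L)))

  module _ (n : ℕ) where

    -- Interpolates between the two sides: the empty partial map at i = 0 gives the sum over all of
    -- `D n`, and at i = 2n a single permutation is left.
    extensions : ℕ → (ℕ → ℕ) → ℕ → Carrier
    extensions i p r = ∑ (D n) (λ s → ⟦ agreeᵇ (ap s) i p ⟧ * remaining s i r)

    permutation : ∀ {s} → s ∈ D n → IsDPermutation (length s) (ap s)
    permutation {s} s∈ = let len , perm = ∈-D⁻ n s∈ in ≡.subst (λ N → IsDPermutation N (ap s)) (≡.sym len) perm

    in-range : ∀ {i r s} → s ∈ D n → i ℕ.+ suc r ≡ 2 ℕ.* n → suc i ≤ length s
    in-range {i} {r} s∈ e = ≡.subst₂ _≤_ (ℕ.+-comm i 1) (≡.trans e (≡.sym (proj₁ (∈-D⁻ n s∈)))) (ℕ.+-monoʳ-≤ i (s≤s z≤n))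

    ∑D-list : ∀ L (a : ℕ → Carrier) (G : ℕ → List ℕ → Carrier) →
              ∑ (D n) (λ s → ∑ L (λ x → a x * G x s)) ≈ ∑ L (λ x → a x * ∑ (D n) (G x))
    ∑D-list L a G = trans (∑-swap (D n) L _) (∑-cong L (λ {x} _ → ∑-*ˡ (D n) (a x) (G x)))

    module _ {i p S V E} (st : State i p S V E) {r} (left : i ℕ.+ suc r ≡ 2 ℕ.* n) where
      private t = suc i

      extensions-odd : isOdd t ≡ true → isEven t ≡ false → extensions i p (suc r) ≈
          y₁ * extensions t p r
        + (∑ S (λ j → pick ŷ₂ v̂₂ S j * extensions t (p [ j ↦ t ]) r)
        + λ′ * (if isEmpty S then zₒ else wₒ) * extensions t (p [ t ↦ t ]) r)
      extensions-odd odd even = trans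
        (∑-cong (D n) (λ {s} s∈ → Step.oddStep {s} (permutation s∈) st (in-range s∈ left) (remaining s t r) odd even))
        (trans (∑-+ (D n) _ _) (+-cong (∑-*ˡ (D n) _ _)
          (trans (∑-+ (D n) _ _) (+-cong (∑D-list S _ _) (∑-*ˡ (D n) _ _)))))

      extensions-even : isOdd t ≡ false → isEven t ≡ true → extensions i p (suc r) ≈
          ∑ V (λ v → ∑ S (λ j → pick x₁ u₁ V v * gate (E v ≡ᵇ j) λ′ * extensions t (p [ t ↦ v ] [ j ↦ t ]) r))
        + (∑ V (λ v → pick x₂ u₂ V v * extensions t (p [ t ↦ v ]) r)
        + λ′ * (if isEmpty S then zₑ else wₑ) * extensions t (p [ t ↦ t ]) r)
      extensions-even odd even = trans
        (∑-cong (D n) (λ {s} s∈ → Step.evenStep {s} (permutation s∈) st (in-range s∈ left) (remaining s t r) odd even))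
        (trans (∑-+ (D n) _ _) (+-cong (trans (∑-swap (D n) V _) (∑-cong V (λ _ → ∑D-list S _ _)))
          (trans (∑-+ (D n) _ _) (+-cong (∑D-list V _ _) (∑-*ˡ (D n) _ _)))))

    extensions-complete : ∀ {p E} → State (2 ℕ.* n) p [] [] E → extensions (2 ℕ.* n) p 0 ≈ 1#
    extensions-complete {p} st = trans
      (∑-single (D-unique n) (word-∈-D n perm) λ {s} s∈ s≢w →
        trans (*-identityʳ _) (reflexive (≡.cong ⟦_⟧ (reflects-false (agreeᵇ-reflects (ap s) N p) λ a → s≢w (determined s∈ a)))))
      (trans (*-identityʳ _) (reflexive (≡.cong ⟦_⟧ (reflects-true (agreeᵇ-reflects (ap (word N p)) N p)
        λ j j∈ → (λ z → contradiction z (image j∈)) , λ _ → ap-word p j∈))))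
      where
      open State st
      N = 2 ℕ.* n
      image : ∀ {j} → j within N → p j ≢ 0
      image j∈ z with () ← ∈S⁺ j∈ z
      perm : IsDPermutation N p
      perm = record
        { maps = λ j∈ → ℕ.n≢0⇒n>0 (image j∈) , bounded (image j∈)
        ; injective = λ i∈ _ → injective (image i∈)
        ; odd-≤ = odd-≤ ∘ image
        ; even-≥ = even-≥ ∘ image }
      determined : ∀ {s} → s ∈ D n → Agree (ap s) N p → s ≡ word N p
      determined {s} s∈ a = ≡.trans (≡.sym (word-ap s)) (≡.trans (≡.cong (λ m → word m (ap s)) (proj₁ (∈-D⁻ n s∈)))
        (word-cong (λ j j∈ → proj₂ (a j j∈) (image j∈))))

    -- A position still pending at 2n would need an image above 2n.
    extensions-incomplete : ∀ {p j S V E} → State (2 ℕ.* n) p (j ∷ S) V E → extensions (2 ℕ.* n) p 0 ≈ 0#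
    extensions-incomplete {p} {j} st = ∑-zero (D n) λ {s} s∈ →
      trans (*-identityʳ _) (reflexive (≡.cong ⟦_⟧ (reflects-false (agreeᵇ-reflects (ap s) (2 ℕ.* n) p) λ a →
        let j∈ , z = State.∈S⁻ st (here ≡.refl) in
        ℕ.<⇒≱ (proj₁ (a j j∈) z) (proj₂ (IsDPermutation.maps (proj₂ (∈-D⁻ n s∈)) j∈)))))

    -- Even positions get their image at once, as σ(2k) ≤ 2k. Thus a pending position is odd and may
    -- be sent to any later t, which is the parity condition of `link`.
    AllOdd : List ℕ → Set
    AllOdd S = ∀ {j} → j ∈ S → isOdd j ≡ true

    -- Induction on the number of remaining positions. By the induction hypothesis a new state
    -- matters only through its number of paths; so all rises, say, have the same continuation, and
    -- only the weights of the choices remain to be summed.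
    extensions≈beforeOdd : ∀ m a {k i p S V E} → State i p S V E → AllOdd S → length S ≡ k →
      i ≡ a ℕ.* 2 → i ℕ.+ m ℕ.* 2 ≡ 2 ℕ.* n → extensions i p (m ℕ.* 2) ≈ beforeOdd m k
    extensions≈beforeEven : ∀ m a {k i p S V E} → State i p S V E → AllOdd S → length S ≡ k →
      i ≡ suc (a ℕ.* 2) → i ℕ.+ suc (m ℕ.* 2) ≡ 2 ℕ.* n → extensions i p (suc (m ℕ.* 2)) ≈ beforeEven m k

    extensions≈beforeOdd zero a {i = i} st _ len _ left with ≡.trans (≡.sym (ℕ.+-identityʳ i)) left
    extensions≈beforeOdd zero a {S = []}    {V = []} st _ ≡.refl _ left | ≡.refl = extensions-complete st
    extensions≈beforeOdd zero a {S = []}    {V = _ ∷ _} st _ _ _ left | ≡.refl with () ← State.balanced st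
    extensions≈beforeOdd zero a {S = _ ∷ _}          st _ ≡.refl _ left | ≡.refl = extensions-incomplete st
    extensions≈beforeOdd (suc m) a {k} {i} {p} {S} {V} st allOdd len ≡.refl left = begin
      extensions i p (suc (suc (m ℕ.* 2)))
        ≈⟨ extensions-odd st left odd (isEven-2k+1 a) ⟩
      y₁ * extensions t p r + (∑ S (λ j → pick ŷ₂ v̂₂ S j * extensions t (p [ j ↦ t ]) r) + fix * extensions t (p [ t ↦ t ]) r)
        ≈⟨ +-cong
             (*-congˡ (extensions≈beforeEven m a ext ext-odd (≡.trans (length-∷ʳ S t) (≡.cong suc len)) ≡.refl left′))
             (+-cong
               (trans (∑-cong S (λ j∈ → *-congˡ (linked (∈-++⁺ˡ j∈) (λ _ → ℕ.<⇒≤ (S-< st j∈))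
                                  (λ e → contradiction (≡.trans (≡.sym e) (allOdd j∈)) λ ()))))
                      (∑-*ʳ S _ _))
               (*-congˡ (linked (∈-∷ʳ-last S) (λ _ → ℕ.≤-refl) (λ _ → ℕ.≤-refl)))) ⟩
      y₁ * beforeEven m (suc k) + (∑ S (pick ŷ₂ v̂₂ S) * beforeEven m k + fix * beforeEven m k)
        ≈⟨ +-congˡ (trans (sym (distribʳ _ _ _)) (*-congʳ (total S (State.S-sorted st) len))) ⟩
      y₁ * beforeEven m (suc k) + riseOrFixWeight k * beforeEven m k ∎
      where
      t = suc i
      r = suc (m ℕ.* 2)
      fix = λ′ * (if isEmpty S then zₒ else wₒ)
      odd = isOdd-2k+1 a
      left′ = ≡.trans (≡.sym (ℕ.+-suc i r)) left
      ext = extend st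
      ext-odd : AllOdd (S ∷ʳ t)
      ext-odd j∈ with ∈-∷ʳ⁻ S j∈
      ... | inj₁ j∈S    = allOdd j∈S
      ... | inj₂ ≡.refl = odd
      linked : ∀ {j} → j ∈ S ∷ʳ t → (isOdd j ≡ true → j ≤ t) → (isOdd j ≡ false → t ≤ j) → extensions t (p [ j ↦ t ]) r ≈ beforeEven m k
      linked {j} j∈ le ge = extensions≈beforeEven m a (link ext j∈ (∈-∷ʳ-last V) le ge) (λ x∈ → ext-odd (proj₁ (∈-∖⁻ (S ∷ʳ t) x∈)))
        (ℕ.suc-injective (≡.trans (length-∖ (sorted⇒unique (State.S-sorted ext)) j∈) (≡.trans (length-∷ʳ S t) (≡.cong suc len))))
        ≡.refl left′
      total : ∀ S → Sorted S → length S ≡ k → ∑ S (pick ŷ₂ v̂₂ S) + λ′ * (if isEmpty S then zₒ else wₒ) ≈ riseOrFixWeight k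
      total []      _      ≡.refl = +-identityˡ _
      total (j ∷ S) sorted ≡.refl = +-congʳ (∑-pick ŷ₂ v̂₂ sorted ≡.refl)

    extensions≈beforeEven m a {k} {i} {p} {S} {V} {E} st allOdd len ≡.refl left = begin
      extensions i p (suc (m ℕ.* 2))
        ≈⟨ extensions-even st left odd (isEven-2k (suc a)) ⟩
      ∑ V (λ v → ∑ S (λ j → pick x₁ u₁ V v * gate (E v ≡ᵇ j) λ′ * extensions t (p [ t ↦ v ] [ j ↦ t ]) r))
        + (∑ V (λ v → pick x₂ u₂ V v * extensions t (p [ t ↦ v ]) r) + fix * extensions t (p [ t ↦ t ]) r)
        ≈⟨ +-cong (peaks k len)
             (trans (+-cong (trans (∑-cong V (λ v∈ → *-congˡ (imaged (∈-++⁺ˡ v∈) (ℕ.<⇒≤ (V-< st v∈))))) (∑-*ʳ V _ _))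
                            (*-congˡ (imaged (∈-∷ʳ-last V) ℕ.≤-refl)))
                    (trans (sym (distribʳ _ _ _)) (*-congʳ (total S V (State.V-sorted st) (State.balanced st) len)))) ⟩
      peakTotal k + fallOrFixWeight k * beforeOdd m k
        ≈⟨ collect k ⟩
      beforeEven m k ∎
      where
      t = suc i
      r = m ℕ.* 2
      fix = λ′ * (if isEmpty S then zₑ else wₑ)
      odd = isOdd-2k (suc a)
      left′ = ≡.trans (≡.sym (ℕ.+-suc i r)) left
      ext = extend st
      peakTotal : ℕ → Carrier
      peakTotal zero    = 0#
      peakTotal (suc k) = peakWeight k * beforeOdd m k
      collect : ∀ k → peakTotal k + fallOrFixWeight k * beforeOdd m k ≈ beforeEven m k
      collect zero    = +-identityˡ _
      collect (suc k) = refl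
      module _ {v} (v∈ : v ∈ V ∷ʳ t) (v≤t : v ≤ t) where
        st₁ = link ext (∈-∷ʳ-last S) v∈ (λ e → contradiction (≡.trans (≡.sym e) odd) λ ()) (λ _ → v≤t)
        st₁-odd : AllOdd ((S ∷ʳ t) ∖ t)
        st₁-odd j∈ with ∈-∖⁻ (S ∷ʳ t) j∈
        ... | j∈′ , j≢t with ∈-∷ʳ⁻ S j∈′
        ...   | inj₁ j∈S = allOdd j∈S
        ...   | inj₂ j≡t = contradiction j≡t j≢t
        st₁-length : length ((S ∷ʳ t) ∖ t) ≡ k
        st₁-length = ℕ.suc-injective (≡.trans (length-∖ (sorted⇒unique (State.S-sorted ext)) (∈-∷ʳ-last S))
          (≡.trans (length-∷ʳ S t) (≡.cong suc len)))
        imaged : extensions t (p [ t ↦ v ]) r ≈ beforeOdd m k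
        imaged = extensions≈beforeOdd m (suc a) st₁ st₁-odd st₁-length ≡.refl left′
      -- The arc from t to v is linked first. As v < t, the value t is still unattained and can take
      -- the second arc, from j.
      peaked : ∀ {v j k′} → v ∈ V → j ∈ S → k ≡ suc k′ → extensions t (p [ t ↦ v ] [ j ↦ t ]) r ≈ beforeOdd m k′
      peaked {v} {j} v∈ j∈ k≡ = extensions≈beforeOdd m (suc a)
        (link (st₁ v∈′ v≤t) j∈′ (∈-∖⁺ (∈-∷ʳ-last V) (ℕ.>⇒≢ (V-< st v∈))) (λ _ → ℕ.<⇒≤ (S-< st j∈))
              (λ e → contradiction (≡.trans (≡.sym e) (allOdd j∈)) λ ()))
        (λ x∈ → st₁-odd v∈′ v≤t (proj₁ (∈-∖⁻ ((S ∷ʳ t) ∖ t) x∈)))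
        (ℕ.suc-injective (≡.trans (length-∖ (sorted⇒unique (State.S-sorted (st₁ v∈′ v≤t))) j∈′)
          (≡.trans (st₁-length v∈′ v≤t) k≡)))
        ≡.refl left′
        where
        v∈′ = ∈-++⁺ˡ v∈
        v≤t = ℕ.<⇒≤ (V-< st v∈)
        j∈′ = ∈-∖⁺ (∈-++⁺ˡ j∈) (ℕ.<⇒≢ (S-< st j∈))
      peaks : ∀ k′ → length S ≡ k′ →
        ∑ V (λ v → ∑ S (λ j → pick x₁ u₁ V v * gate (E v ≡ᵇ j) λ′ * extensions t (p [ t ↦ v ] [ j ↦ t ]) r)) ≈ peakTotal k′
      peaks zero     len₀ = ∑-zero V λ v∈ → contradiction (State.E∈S st v∈) (empty len₀)
        where
        empty : ∀ {L x} → length L ≡ 0 → ¬ x ∈ L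
        empty {[]} _ ()
      peaks (suc k′) len₁ = begin
        ∑ V (λ v → ∑ S (λ j → pick x₁ u₁ V v * gate (E v ≡ᵇ j) λ′ * extensions t (p [ t ↦ v ] [ j ↦ t ]) r))
          ≈⟨ ∑-cong V (λ {v} v∈ → begin
               ∑ S (λ j → pick x₁ u₁ V v * gate (E v ≡ᵇ j) λ′ * extensions t (p [ t ↦ v ] [ j ↦ t ]) r)
                 ≈⟨ ∑-cong S (λ {j} j∈ → *-congˡ (peaked v∈ j∈ (≡.trans (≡.sym len) len₁))) ⟩
               ∑ S (λ j → pick x₁ u₁ V v * gate (E v ≡ᵇ j) λ′ * beforeOdd m k′)
                 ≈⟨ ∑-*ʳ S _ _ ⟩
               ∑ S (λ j → pick x₁ u₁ V v * gate (E v ≡ᵇ j) λ′) * beforeOdd m k′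
                 ≈⟨ *-congʳ (∑-*ˡ S _ _) ⟩
               pick x₁ u₁ V v * ∑ S (λ j → gate (E v ≡ᵇ j) λ′) * beforeOdd m k′
                 ≈⟨ *-congʳ (*-congˡ (∑-gate (State.S-sorted st) (State.E∈S st v∈) len₁)) ⟩
               pick x₁ u₁ V v * (λ′ + nat k′) * beforeOdd m k′ ∎) ⟩
        ∑ V (λ v → pick x₁ u₁ V v * (λ′ + nat k′) * beforeOdd m k′)
          ≈⟨ trans (∑-*ʳ V _ _) (*-congʳ (∑-*ʳ V _ _)) ⟩
        ∑ V (pick x₁ u₁ V) * (λ′ + nat k′) * beforeOdd m k′
          ≈⟨ *-congʳ (trans (*-comm _ _) (*-congˡ (∑-pick x₁ u₁ (State.V-sorted st) (≡.trans (≡.sym (State.balanced st)) len₁)))) ⟩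
        peakWeight k′ * beforeOdd m k′ ∎
      total : ∀ S V → Sorted V → length S ≡ length V → length S ≡ k →
              ∑ V (pick x₂ u₂ V) + λ′ * (if isEmpty S then zₑ else wₑ) ≈ fallOrFixWeight k
      total []      []      _      _ ≡.refl = +-identityˡ _
      total (_ ∷ S) (v ∷ V) sorted e ≡.refl = +-congʳ (∑-pick x₂ u₂ sorted (≡.sym e))

  Pnn≈Tfrac : ∀ n → Pnn x₁ x₂ y₁ ŷ₂ u₁ u₂ y₁ v̂₂ wₑ wₒ zₑ zₒ λ′ n ≈
                    Tfrac (alpha42 x₁ x₂ y₁ ŷ₂ u₁ u₂ v̂₂ wₑ wₒ λ′) (delta42 zₑ zₒ λ′) n
  Pnn≈Tfrac n = begin
    Pnn x₁ x₂ y₁ ŷ₂ u₁ u₂ y₁ v̂₂ wₑ wₒ zₑ zₒ λ′ n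
      ≈⟨ ∑-cong (D n) (λ {s} s∈ → begin
           _ ≈⟨ totalWeight s (permutation n s∈) ⟩
           ∏ (range (length s)) (weight s)
             ≈⟨ ∏-range s (length s) ⟩
           remaining s 0 (length s)
             ≡⟨ ≡.cong (remaining s 0) (≡.trans (proj₁ (∈-D⁻ n s∈)) (ℕ.*-comm 2 n)) ⟩
           remaining s 0 (n ℕ.* 2)
             ≈⟨ *-identityˡ _ ⟨
           1# * remaining s 0 (n ℕ.* 2) ∎) ⟩
    extensions n 0 (λ _ → 0) (n ℕ.* 2)
      ≈⟨ extensions≈beforeOdd n n 0 initial (λ ()) ≡.refl ≡.refl (ℕ.*-comm n 2) ⟩
    beforeOdd n 0
      ≈⟨ beforeOdd≈Tfrac n ⟩
    Tfrac (alpha42 x₁ x₂ y₁ ŷ₂ u₁ u₂ v̂₂ wₑ wₒ λ′) (delta42 zₑ zₒ λ′) n ∎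

open CommutativeRing using (Carrier; _≈_)

theorem4p2 : ∀ {c ℓ} (R : CommutativeRing c ℓ)
    → (x₁ x₂ y₁ ŷ₂ u₁ u₂ v̂₂ wₑ wₒ zₑ zₒ λ′ : Carrier R) (n : ℕ)
    → _≈_ R (WithRing.Pnn R x₁ x₂ y₁ ŷ₂ u₁ u₂ y₁ v̂₂ wₑ wₒ zₑ zₒ λ′ n)
    (WithRing.Tfrac R (WithRing.alpha42 R x₁ x₂ y₁ ŷ₂ u₁ u₂ v̂₂ wₑ wₒ λ′)
    (WithRing.delta42 R zₑ zₒ λ′) n)
theorem4p2 R x₁ x₂ y₁ ŷ₂ u₁ u₂ v̂₂ wₑ wₒ zₑ zₒ λ′ = Main.Pnn≈Tfrac R x₁ x₂ y₁ ŷ₂ u₁ u₂ v̂₂ wₑ wₒ zₑ zₒ λ′
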